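{- Let $G$ be a connected graph and let $D$ be a connected $3$-way dominating set of $G$. Then $px_3(G)\le px_3(G[D])+3$. Moreover, this bound is tight: there exist connected graphs $G$ with a connected $3$-way dominating set $D$ for which $px_3(G)=px_3(G[D])+3$.
   Context: All graphs are finite, simple and undirected. In an edge-colored graph (adjacent edges may receive the same color), a tree is proper if no two adjacent edges of it receive the same color. For a connected graph $G$ of order $n$, an integer $2\le k\le n$ and $S\subseteq V(G)$, an $S$-tree is a tree in $G$ containing all vertices of $S$. An edge-coloring of $G$ is a $k$-proper coloring if for every $k$-subset $S$ of $V(G)$ there is a proper $S$-tree in $G$; $px_k(G)$ is the minimum number of colors in a $k$-proper coloring of $G$. For $D\subseteq V(G)$, $\overline{D}=V(G)\setminus D$ and $G[D]$ is the induced subgraph. $D$ is a dominating set if every vertex of $\overline{D}$ has a neighbor in $D$; it is a connected $3$-way dominating set if it is dominating, $G[D]$ is connected, and every vertex $v\in\overline{D}$ has degree $d(v)\ge 3$ in $G$. When $|D|\le 2$, $px_3(G[D])$ is understood as the minimum number of colors needed so that all vertices of $G[D]$ lie in a proper tree of $G[D]$ (i.e. $0$ if $|D|=1$ and $1$ if $|D|=2$). -}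

module Defs where

open import Data.Nat using (ℕ; _<_; _≤_; _⊓_; _+_)
open import Data.Bool using (Bool; true; false)
open import Data.Fin using (Fin)
open import Data.Fin.Subset using (Subset; _∈_; _∉_; _⊆_; ∣_∣; ⊤; Nonempty)
open import Data.List using (List; _∷_; _∷ʳ_; length)
open import Data.List.Relation.Unary.Unique.Propositional using (Unique)
open import Data.List.Relation.Unary.Linked using (Linked)
open import Data.Vec using (tabulate)
open import Data.Product using (Σ; ∃; ∃-syntax; _×_; _,_)
open import Relation.Nullary using (¬_)
open import Relation.Binary.PropositionalEquality using (_≡_; _≢_)
open import Relation.Binary.Construct.Closure.ReflexiveTransitive using (Star)

record Graph (n : ℕ) : Set where
  field
    adj    : Fin n → Fin n → Bool
    sym    : ∀ u v → adj u v ≡ adj v u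
    irrefl : ∀ u → adj u u ≡ false
open Graph public

Edge : ∀ {n} → Graph n → Fin n → Fin n → Set
Edge G u v = adj G u v ≡ true

Connected : ∀ {n} → Graph n → Set
Connected {n} G = (0 < n) × (∀ u v → Star (Edge G) u v)

degree : ∀ {n} → Graph n → Fin n → ℕ
degree G v = ∣ tabulate (adj G v) ∣

InducedConnected : ∀ {n} → Graph n → Subset n → Set
InducedConnected G D =
  Nonempty D × (∀ u v → u ∈ D → v ∈ D → Star (λ a b → a ∈ D × b ∈ D × Edge G a b) u v)

Dominating : ∀ {n} → Graph n → Subset n → Set
Dominating G D = ∀ v → v ∉ D → ∃[ u ] (u ∈ D × Edge G u v)

Connected3WayDominating : ∀ {n} → Graph n → Subset n → Set
Connected3WayDominating G D =
  Dominating G D × InducedConnected G D × (∀ v → v ∉ D → 3 ≤ degree G v)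

HasCycle : ∀ {n} → (Fin n → Fin n → Bool) → Set
HasCycle {n} E = ∃[ x ] ∃[ rest ]
  (2 ≤ length rest × Unique (x ∷ rest) × Linked (λ a b → E a b ≡ true) ((x ∷ rest) ∷ʳ x))

record IsTreeIn {n} (G : Graph n) (U : Subset n)
                (T : Subset n) (E : Fin n → Fin n → Bool) : Set where
  field
    T⊆U      : T ⊆ U
    nonempty : Nonempty T
    sub      : ∀ u v → E u v ≡ true → Edge G u v
    ends     : ∀ u v → E u v ≡ true → u ∈ T × v ∈ T
    symE     : ∀ u v → E u v ≡ E v u
    conn     : ∀ u v → u ∈ T → v ∈ T → Star (λ a b → E a b ≡ true) u v
    acyclic  : ¬ HasCycle E

-- An edge colouring of G[U] with c colours (colours 0..c-1); only the
-- values on edges of G[U] are meaningful.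
IsColoring : ∀ {n} → Graph n → Subset n → ℕ → (Fin n → Fin n → ℕ) → Set
IsColoring G U c col =
  (∀ u v → u ∈ U → v ∈ U → Edge G u v → col u v < c) ×
  (∀ u v → u ∈ U → v ∈ U → Edge G u v → col u v ≡ col v u)

ProperEdges : ∀ {n} → (Fin n → Fin n → ℕ) → (Fin n → Fin n → Bool) → Set
ProperEdges col E =
  ∀ u v w → E u v ≡ true → E u w ≡ true → v ≢ w → col u v ≢ col u w

-- k-proper colouring of G[U]: every S ⊆ U with |S| = min(k, |U|) lies in a
-- proper tree of G[U]. (For |U| ≥ k this is the paper's definition; for
-- |U| < k it is the stated convention: all vertices of G[U] lie in a proper tree.)
KProper : ∀ {n} → Graph n → Subset n → ℕ → (Fin n → Fin n → ℕ) → Set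
KProper {n} G U k col =
  ∀ (S : Subset n) → S ⊆ U → ∣ S ∣ ≡ k ⊓ ∣ U ∣ →
    ∃[ T ] ∃[ E ] (IsTreeIn G U T E × S ⊆ T × ProperEdges col E)

Colorable : ∀ {n} → Graph n → Subset n → ℕ → ℕ → Set
Colorable {n} G U k c =
  ∃[ col ] (IsColoring G U c col × KProper G U k col)

IsPx : ∀ {n} → Graph n → Subset n → ℕ → ℕ → Set
IsPx G U k m = Colorable G U k m × (∀ c → Colorable G U k c → m ≤ c)

{-# OPTIONS --safe #-}

-- Split the vertices outside D into three classes, identified with three new colours. Every vertex v outside D has a
-- main leg, an edge to a vertex foot v of D, coloured with the class of v; an edge outside D between different classes
-- gets the colour of the third class. A walk outside D through pairwise different classes that finally descends to D
-- along a main leg is then properly coloured, and the colour of that leg is the class of its last vertex. Suppose that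
-- every vertex of class i either sees both other colours in one step (a neighbour, or a further leg of its own), or has
-- two neighbours of one class j, one of them with a neighbour of the third class k. Then any three vertices outside D
-- descend by disjoint routes ending in legs of different colours, or two of them share a route, and a proper tree of
-- G[D] joins the feet.
--
-- Such a partition is built greedily by walking along uncoloured vertices. The condition survives colouring further
-- vertices, and since each vertex outside D has two edges besides its main leg, the walk can always be prolonged or
-- closed up.
--
-- Three copies of K₄ sharing a vertex u, with D = {u}, attain the bound: a tree meeting all three triangles has three
-- edges at u.
module Submission where

open import Defs
open import Data.Nat using (ℕ; zero; suc; _+_; _≤_; _<_; z≤n; s≤s)
open import Data.Nat.DivMod using (_/_)
open import Data.Nat.Properties using (_≤?_; ≤-trans; ≤-refl; ≤-reflexive; ≤-antisym; ≤-pred; ≰⇒>; <-trans; <-≤-trans; <⇒≢; n≤1+n; m≤m+n; +-suc; +-monoʳ-≤; +-monoʳ-<; +-cancelˡ-≡; ⊓-glb; m⊓n≤m; m⊓n≤n) renaming (_≟_ to _≟ℕ_)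
open import Data.Bool using (Bool; true; false; not; _∧_; _∨_) renaming (_≟_ to _≟ᵇ_)
open import Data.Fin using (Fin; zero; suc; toℕ; fromℕ<; #_)
open import Data.Fin.Patterns using (0F; 1F; 2F)
open import Data.Fin.Properties using (_≟_; any?; all?; toℕ-injective; toℕ<n; pigeonhole; fromℕ<-injective)
open import Data.Fin.Subset using (Subset; inside; outside; _∈_; _∉_; _⊆_; ∣_∣; ⊤; ⊥; ⁅_⁆; _∪_)
open import Data.Fin.Subset.Properties using (_∈?_; ∈⊤; ⊆-refl; x∈⁅x⁆; x∈⁅y⁆⇒x≡y; ∣⁅x⁆∣≡1; ∣⊥∣≡0; p⊆q⇒∣p∣≤∣q∣; p⊂q⇒∣p∣<∣q∣; x∈p∪q⁺; x∈p∪q⁻; drop-∷-⊆; s⊆s; out⊆)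
open import Data.Maybe using (Maybe; just; nothing; is-nothing)
open import Data.Maybe.Properties using (just-injective)
open import Data.Vec using ([]; _∷_; tabulate; here; there)
open import Data.Vec.Properties using (lookup∘tabulate; []=⇒lookup; lookup⇒[]=)
open import Data.List using (List; []; _∷_; _∷ʳ_; _++_; length; map)
open import Data.List.Properties using (length-map)
open import Data.List.Membership.Propositional using () renaming (_∈_ to _∈ₗ_; _∉_ to _∉ₗ_)
open import Data.List.Membership.Propositional.Properties using (∈-map⁺; ∈-++⁺ˡ; ∈-++⁺ʳ; ∈-++⁻)
open import Data.List.Relation.Unary.Any using (here; there) renaming (any? to any-list?)
open import Data.List.Relation.Unary.All as All using (All; []; _∷_)
open import Data.List.Relation.Unary.All.Properties using (¬Any⇒All¬; ∷ʳ⁺)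
open import Data.List.Relation.Unary.AllPairs using ([]; _∷_)
open import Data.List.Relation.Unary.Unique.Propositional using (Unique)
open import Data.List.Relation.Unary.Linked using (Linked; []; [-]; _∷_)
open import Data.List.Relation.Binary.Permutation.Propositional using (↭-sym)
open import Data.List.Relation.Binary.Permutation.Propositional.Properties using (shift; ∈-resp-↭)
open import Data.Product using (Σ; ∃; ∃-syntax; ∃₂; _×_; _,_; proj₁; proj₂)
open import Data.Sum as Sum using (_⊎_; inj₁; inj₂)
open import Data.Unit using (tt)
open import Relation.Nullary using (¬_; Dec; yes; no; contradiction)
open import Relation.Nullary.Decidable as Dec using (⌊_⌋; decidable-stable; ¬?; _×-dec_; _→-dec_; toWitness)
open import Relation.Binary.Construct.Closure.ReflexiveTransitive as Star using (Star; ε; _◅_; _◅◅_)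
open import Relation.Binary.PropositionalEquality as ≡ using (_≡_; _≢_; refl; cong; subst; trans; ≢-sym)

-- Finite subsets and lists of vertices

private
  variable
    n : ℕ

∈-tabulate⁺ : ∀ (f : Fin n → Bool) {i} → f i ≡ true → i ∈ tabulate f
∈-tabulate⁺ f {i} eq = lookup⇒[]= i _ (trans (lookup∘tabulate f i) eq)

∈-tabulate⁻ : ∀ (f : Fin n → Bool) {i} → i ∈ tabulate f → f i ≡ true
∈-tabulate⁻ f {i} i∈ = trans (≡.sym (lookup∘tabulate f i)) ([]=⇒lookup i∈)

∣p∪q∣≤∣p∣+∣q∣ : ∀ (p q : Subset n) → ∣ p ∪ q ∣ ≤ ∣ p ∣ + ∣ q ∣
∣p∪q∣≤∣p∣+∣q∣ []            []            = z≤n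
∣p∪q∣≤∣p∣+∣q∣ (outside ∷ p) (outside ∷ q) = ∣p∪q∣≤∣p∣+∣q∣ p q
∣p∪q∣≤∣p∣+∣q∣ (outside ∷ p) (inside  ∷ q) =
  ≤-trans (s≤s (∣p∪q∣≤∣p∣+∣q∣ p q)) (≤-reflexive (≡.sym (+-suc ∣ p ∣ ∣ q ∣)))
∣p∪q∣≤∣p∣+∣q∣ (inside  ∷ p) (outside ∷ q) = s≤s (∣p∪q∣≤∣p∣+∣q∣ p q)
∣p∪q∣≤∣p∣+∣q∣ (inside  ∷ p) (inside  ∷ q) =
  s≤s (≤-trans (∣p∪q∣≤∣p∣+∣q∣ p q) (+-monoʳ-≤ ∣ p ∣ (n≤1+n _)))

∣S∣≤length : ∀ (S : Subset n) (xs : List (Fin n)) → (∀ {v} → v ∈ S → v ∈ₗ xs) → ∣ S ∣ ≤ length xs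
∣S∣≤length {n} S xs S⊆xs = ≤-trans (p⊆q⇒∣p∣≤∣q∣ (λ v∈S → into xs (S⊆xs v∈S))) (bound xs)
  where
  union : List (Fin n) → Subset n
  union []       = ⊥
  union (x ∷ xs) = ⁅ x ⁆ ∪ union xs

  into : ∀ xs {v} → v ∈ₗ xs → v ∈ union xs
  into (x ∷ xs) (here refl) = x∈p∪q⁺ (inj₁ (x∈⁅x⁆ x))
  into (x ∷ xs) (there v∈)  = x∈p∪q⁺ (inj₂ (into xs v∈))

  bound : ∀ xs → ∣ union xs ∣ ≤ length xs
  bound []       = ≤-reflexive (∣⊥∣≡0 n)
  bound (x ∷ xs) = ≤-trans (∣p∪q∣≤∣p∣+∣q∣ ⁅ x ⁆ (union xs))
                     (subst (λ k → k + ∣ union xs ∣ ≤ suc (length xs)) (≡.sym (∣⁅x⁆∣≡1 x)) (s≤s (bound xs)))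

elements : ∀ (S : Subset n) → ∃[ xs ] (length xs ≡ ∣ S ∣ × (∀ {v} → v ∈ S → v ∈ₗ xs))
elements []            = [] , refl , λ ()
elements (outside ∷ S) with elements S
... | xs , eq , S⊆xs = map suc xs , trans (length-map suc xs) eq , λ { (there v∈S) → ∈-map⁺ suc (S⊆xs v∈S) }
elements (inside ∷ S) with elements S
... | xs , eq , S⊆xs = zero ∷ map suc xs , cong suc (trans (length-map suc xs) eq) ,
      λ { here → here refl ; (there v∈S) → there (∈-map⁺ suc (S⊆xs v∈S)) }

-- Repetition pads a smaller set, so that later only triples have to be joined; `d` serves the empty
-- set.
atMostThree : ∀ (S : Subset n) → Fin n → ∣ S ∣ ≤ 3 →
              ∃[ x ] ∃[ y ] ∃[ z ] (∀ {v} → v ∈ S → v ∈ₗ x ∷ y ∷ z ∷ [])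
atMostThree S d ∣S∣≤3 with elements S
... | []             , _  , S⊆ = d , d , d , λ v∈S → contradiction (S⊆ v∈S) λ ()
... | x ∷ []         , _  , S⊆ = x , x , x , λ v∈S → pad (S⊆ v∈S)
  where
  pad : ∀ {v} → v ∈ₗ x ∷ [] → v ∈ₗ x ∷ x ∷ x ∷ []
  pad (here e) = here e
... | x ∷ y ∷ []     , _  , S⊆ = x , y , y , λ v∈S → pad (S⊆ v∈S)
  where
  pad : ∀ {v} → v ∈ₗ x ∷ y ∷ [] → v ∈ₗ x ∷ y ∷ y ∷ []
  pad (here e)         = here e
  pad (there (here e)) = there (here e)
... | x ∷ y ∷ z ∷ [] , _  , S⊆ = x , y , z , S⊆
... | _ ∷ _ ∷ _ ∷ _ ∷ _ , eq , _ with s≤s (s≤s (s≤s ())) ← ≤-trans (≤-reflexive eq) ∣S∣≤3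

-- `KProper` speaks only of sets of one exact size, so smaller sets have to be filled up. Elements
-- of `U` are taken greedily as long as the rest of `S` still fits.
between : ∀ {S U : Subset n} {m} → S ⊆ U → ∣ S ∣ ≤ m → m ≤ ∣ U ∣ →
          ∃[ M ] (S ⊆ M × M ⊆ U × ∣ M ∣ ≡ m)
between {S = []} {[]} {zero} _ _ _ = [] , (λ ()) , (λ ()) , refl
between {S = inside ∷ S} {outside ∷ U} S⊆U _ _ with () ← S⊆U here
between {S = inside ∷ S} {inside ∷ U} {suc m} S⊆U (s≤s l) (s≤s h)
  with between (drop-∷-⊆ S⊆U) l h
... | M , S⊆M , M⊆U , eq = inside ∷ M , s⊆s S⊆M , s⊆s M⊆U , cong suc eq
between {S = outside ∷ S} {outside ∷ U} S⊆U l h with between (drop-∷-⊆ S⊆U) l h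
... | M , S⊆M , M⊆U , eq = outside ∷ M , s⊆s S⊆M , s⊆s M⊆U , eq
between {S = outside ∷ S} {inside ∷ U} {zero} S⊆U l h with between {m = zero} (drop-∷-⊆ S⊆U) l z≤n
... | M , S⊆M , M⊆U , eq = outside ∷ M , s⊆s S⊆M , out⊆ M⊆U , eq
between {S = outside ∷ S} {inside ∷ U} {suc m} S⊆U l (s≤s h) with ∣ S ∣ ≤? m
... | yes l′ with between (drop-∷-⊆ S⊆U) l′ h
...   | M , S⊆M , M⊆U , eq = inside ∷ M , out⊆ S⊆M , s⊆s M⊆U , cong suc eq
between {S = outside ∷ S} {inside ∷ U} {suc m} S⊆U l (s≤s h) | no ≰m =
  outside ∷ S , ⊆-refl , out⊆ (drop-∷-⊆ S⊆U) , ≤-antisym l (≰⇒> ≰m)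

-- Otherwise two vertices would exhaust the neighbourhood. The upper bound uses the degree
-- hypothesis only through this lemma.
avoidTwo : ∀ (G : Graph n) {v} → 3 ≤ degree G v → ∀ x y → ∃[ w ] (Edge G v w × w ≢ x × w ≢ y)
avoidTwo G {v} 3≤d x y with any? (λ w → (adj G v w ≟ᵇ true) ×-dec ¬? (w ≟ x) ×-dec ¬? (w ≟ y))
... | yes w = w
... | no ∄w = contradiction (≤-trans 3≤d (∣S∣≤length _ (x ∷ y ∷ []) listed)) λ { (s≤s (s≤s ())) }
  where
  listed : ∀ {w} → w ∈ tabulate (adj G v) → w ∈ₗ x ∷ y ∷ []
  listed {w} w∈ with w ≟ x | w ≟ y
  ... | yes e | _     = here e
  ... | no _  | yes e = there (here e)
  ... | no a  | no b  = contradiction (w , ∈-tabulate⁻ _ w∈ , a , b) ∄w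

-- Neighbours on a cycle

module _ {A : Set} {R : A → A → Set} where

  pred-of-last : ∀ y ys {x} → Linked R (y ∷ ys ∷ʳ x) → ∃[ l ] (l ∈ₗ y ∷ ys × R l x)
  pred-of-last y []       (r ∷ _)  = y , here refl , r
  pred-of-last y (z ∷ zs) (_ ∷ rs) with pred-of-last z zs rs
  ... | l , l∈ , r = l , there l∈ , r

  interior-nbrs : ∀ {x t} p ys → Linked R (p ∷ ys ∷ʳ x) → Unique (p ∷ ys) → p ≢ x → All (_≢ x) ys →
                  t ∈ₗ ys → ∃₂ λ a b → a ≢ b × R a t × R t b
  interior-nbrs p (y ∷ [])     (r ∷ r′ ∷ _) _ p≢x _ (here refl) = p , _ , p≢x , r , r′
  interior-nbrs p (y ∷ z ∷ zs) (r ∷ r′ ∷ _) ((_ ∷ p≢z ∷ _) ∷ _) _ _ (here refl) = p , z , p≢z , r , r′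
  interior-nbrs p (y ∷ ys)     (_ ∷ rs) (_ ∷ u) _ (y≢x ∷ ≢x) (there t∈) = interior-nbrs y ys rs u y≢x ≢x t∈

  -- Serves to show that a leaf lies on no cycle. The second vertex is treated apart because its
  -- predecessor is the closing vertex `x` itself, which `interior-nbrs` excludes.
  cycle-nbrs : ∀ x ys {t} → 2 ≤ length ys → Unique (x ∷ ys) → Linked R ((x ∷ ys) ∷ʳ x) →
               t ∈ₗ x ∷ ys → ∃₂ λ a b → a ≢ b × R a t × R t b
  cycle-nbrs x (_ ∷ []) (s≤s ()) _ _ _
  cycle-nbrs x (y ∷ z ∷ zs) _ (_ ∷ (y≢ ∷ _)) (r ∷ _ ∷ rs) (here refl) with pred-of-last z zs rs
  ... | l , l∈ , r′ = l , y , (λ l≡y → All.lookup y≢ l∈ (≡.sym l≡y)) , r′ , r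
  cycle-nbrs x (y ∷ z ∷ zs) _ ((_ ∷ x≢z ∷ _) ∷ _) (r ∷ r′ ∷ _) (there (here refl)) = x , z , x≢z , r , r′
  cycle-nbrs x (y ∷ ys@(_ ∷ _)) _ ((x≢y ∷ x≢ys) ∷ u) (_ ∷ rs) (there (there t∈)) =
    interior-nbrs y ys rs u (λ e → x≢y (≡.sym e)) (All.map (λ x≢ e → x≢ (≡.sym e)) x≢ys) t∈

Linked-All-map : ∀ {A : Set} {R S : A → A → Set} {P : A → Set} → (∀ {a b} → P a → P b → R a b → S a b) →
                 ∀ {xs} → All P xs → Linked R xs → Linked S xs
Linked-All-map f _               []       = []
Linked-All-map f _               [-]      = [-]
Linked-All-map f (pa ∷ pb ∷ ps)  (r ∷ rs) = f pa pb r ∷ Linked-All-map f (pb ∷ ps) rs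

≡true-⇔ : ∀ {x y} → (x ≡ true → y ≡ true) → (y ≡ true → x ≡ true) → x ≡ y
≡true-⇔ {true}  {true}  _ _ = refl
≡true-⇔ {true}  {false} f _ = ≡.sym (f refl)
≡true-⇔ {false} {true}  _ g = g refl
≡true-⇔ {false} {false} _ _ = refl

Edge-sym : ∀ (G : Graph n) {u v} → Edge G u v → Edge G v u
Edge-sym G {u} {v} e = trans (Graph.sym G v u) e

-- Adding a leaf to a tree

addEdge : Fin n → Fin n → (Fin n → Fin n → Bool) → Fin n → Fin n → Bool
addEdge s t E a b = E a b ∨ (⌊ a ≟ s ⌋ ∧ ⌊ b ≟ t ⌋) ∨ (⌊ a ≟ t ⌋ ∧ ⌊ b ≟ s ⌋)

module _ (s t : Fin n) (E : Fin n → Fin n → Bool) where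

  addEdge⁻ : ∀ a b → addEdge s t E a b ≡ true → E a b ≡ true ⊎ (a ≡ s × b ≡ t) ⊎ (a ≡ t × b ≡ s)
  addEdge⁻ a b e with E a b | a ≟ s | b ≟ t | a ≟ t | b ≟ s
  ... | true  | _     | _     | _     | _     = inj₁ refl
  ... | false | yes p | yes q | _     | _     = inj₂ (inj₁ (p , q))
  ... | false | _     | _     | yes p | yes q = inj₂ (inj₂ (p , q))
  addEdge⁻ a b () | false | yes p | no q  | yes _ | no _
  addEdge⁻ a b () | false | yes p | no q  | no _  | _
  addEdge⁻ a b () | false | no p  | _     | yes _ | no _
  addEdge⁻ a b () | false | no p  | _     | no _  | _

  addEdge-old : ∀ a b → E a b ≡ true → addEdge s t E a b ≡ true
  addEdge-old a b e rewrite e = refl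

  addEdge-new : addEdge s t E s t ≡ true
  addEdge-new with E s t | s ≟ s | t ≟ t
  ... | true  | _      | _      = refl
  ... | false | yes _  | yes _  = refl
  ... | false | no s≢s | _      = contradiction refl s≢s
  ... | false | yes _  | no t≢t = contradiction refl t≢t

  addEdge-new′ : addEdge s t E t s ≡ true
  addEdge-new′ with E t s | t ≟ s | s ≟ t | t ≟ t | s ≟ s
  ... | true  | _     | _     | _      | _      = refl
  ... | false | yes _ | yes _ | _      | _      = refl
  ... | false | yes _ | no _  | yes _  | yes _  = refl
  ... | false | no _  | _     | yes _  | yes _  = refl
  ... | false | _     | _     | no t≢t | _      = contradiction refl t≢t
  ... | false | _     | _     | _      | no s≢s = contradiction refl s≢s

_∈ₗ?_ : ∀ (v : Fin n) vs → Dec (v ∈ₗ vs)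
v ∈ₗ? vs = any-list? (v ≟_) vs

module _ {G : Graph n} {U T : Subset n} {E : Fin n → Fin n → Bool} {s t : Fin n} where

  leaf-nbr : IsTreeIn G U T E → t ∉ T → ∀ {w} → addEdge s t E t w ≡ true → w ≡ s
  leaf-nbr tr t∉T {w} e with addEdge⁻ s t E t w e
  ... | inj₁ old               = contradiction (proj₁ (IsTreeIn.ends tr t w old)) t∉T
  ... | inj₂ (inj₁ (t≡s , w≡t)) = trans w≡t t≡s
  ... | inj₂ (inj₂ (_ , w≡s))   = w≡s

  -- Every walk is routed through `s`. A cycle through `t` would give it two neighbours against
  -- `leaf-nbr`, and a cycle avoiding `t` is already a cycle of `E`.
  addLeaf : IsTreeIn G U T E → s ∈ T → t ∉ T → t ∈ U → Edge G s t →
            IsTreeIn G U (T ∪ ⁅ t ⁆) (addEdge s t E)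
  addLeaf tr s∈T t∉T t∈U st = record
    { T⊆U      = λ v∈ → T′⊆U (x∈p∪q⁻ T ⁅ t ⁆ v∈)
    ; nonempty = s , old∈ s∈T
    ; sub      = sub′
    ; ends     = ends′
    ; symE     = λ u v → ≡true-⇔ (flip′ u v) (flip′ v u)
    ; conn     = λ u v u∈ v∈ → toRoot u∈ ◅◅ fromRoot v∈
    ; acyclic  = acyclic′
    }
    where
    open IsTreeIn tr
    E′ = addEdge s t E

    old∈ : ∀ {v} → v ∈ T → v ∈ T ∪ ⁅ t ⁆
    old∈ v∈T = x∈p∪q⁺ (inj₁ v∈T)

    new∈ : t ∈ T ∪ ⁅ t ⁆
    new∈ = x∈p∪q⁺ (inj₂ (x∈⁅x⁆ t))

    T′⊆U : ∀ {v} → v ∈ T ⊎ v ∈ ⁅ t ⁆ → v ∈ U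
    T′⊆U (inj₁ v∈T) = T⊆U v∈T
    T′⊆U (inj₂ v∈)  = subst (_∈ U) (≡.sym (x∈⁅y⁆⇒x≡y t v∈)) t∈U

    sub′ : ∀ u v → E′ u v ≡ true → Edge G u v
    sub′ u v e with addEdge⁻ s t E u v e
    ... | inj₁ old                  = sub u v old
    ... | inj₂ (inj₁ (refl , refl)) = st
    ... | inj₂ (inj₂ (refl , refl)) = Edge-sym G st

    ends′ : ∀ u v → E′ u v ≡ true → u ∈ T ∪ ⁅ t ⁆ × v ∈ T ∪ ⁅ t ⁆
    ends′ u v e with addEdge⁻ s t E u v e
    ... | inj₁ old                  = old∈ (proj₁ (ends u v old)) , old∈ (proj₂ (ends u v old))
    ... | inj₂ (inj₁ (refl , refl)) = old∈ s∈T , new∈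
    ... | inj₂ (inj₂ (refl , refl)) = new∈ , old∈ s∈T

    flip′ : ∀ u v → E′ u v ≡ true → E′ v u ≡ true
    flip′ u v e with addEdge⁻ s t E u v e
    ... | inj₁ old                  = addEdge-old s t E v u (trans (symE v u) old)
    ... | inj₂ (inj₁ (refl , refl)) = addEdge-new′ s t E
    ... | inj₂ (inj₂ (refl , refl)) = addEdge-new s t E

    lift : ∀ {u v} → Star (λ a b → E a b ≡ true) u v → Star (λ a b → E′ a b ≡ true) u v
    lift = Star.map (λ {a} {b} → addEdge-old s t E a b)

    toRoot : ∀ {u} → u ∈ T ∪ ⁅ t ⁆ → Star (λ a b → E′ a b ≡ true) u s
    toRoot {u} u∈ with x∈p∪q⁻ T ⁅ t ⁆ u∈
    ... | inj₁ u∈T = lift (conn u s u∈T s∈T)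
    ... | inj₂ u∈t rewrite x∈⁅y⁆⇒x≡y t u∈t = addEdge-new′ s t E ◅ ε

    fromRoot : ∀ {u} → u ∈ T ∪ ⁅ t ⁆ → Star (λ a b → E′ a b ≡ true) s u
    fromRoot {u} u∈ with x∈p∪q⁻ T ⁅ t ⁆ u∈
    ... | inj₁ u∈T = lift (conn s u s∈T u∈T)
    ... | inj₂ u∈t rewrite x∈⁅y⁆⇒x≡y t u∈t = addEdge-new s t E ◅ ε

    strip : ∀ {a b} → t ≢ a → t ≢ b → E′ a b ≡ true → E a b ≡ true
    strip {a} {b} t≢a t≢b e with addEdge⁻ s t E a b e
    ... | inj₁ old              = old
    ... | inj₂ (inj₁ (_ , b≡t)) = contradiction (≡.sym b≡t) t≢b
    ... | inj₂ (inj₂ (a≡t , _)) = contradiction (≡.sym a≡t) t≢a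

    acyclic′ : ¬ HasCycle E′
    acyclic′ (x , ys , 2≤ , u , l) with t ∈ₗ? (x ∷ ys)
    ... | yes t∈ with cycle-nbrs x ys 2≤ u l t∈
    ...   | a , b , a≢b , at , tb = a≢b (trans (leaf-nbr tr t∉T (flip′ a t at)) (≡.sym (leaf-nbr tr t∉T tb)))
    acyclic′ (x , ys , 2≤ , u , l) | no t∉ =
      acyclic (x , ys , 2≤ , u , Linked-All-map strip (All-∷ʳ (¬Any⇒All¬ _ t∉)) l)
      where
      All-∷ʳ : All (t ≢_) (x ∷ ys) → All (t ≢_) ((x ∷ ys) ∷ʳ x)
      All-∷ʳ (px ∷ ps) = px ∷ ∷ʳ⁺ ps px

  -- At `t` there is a single edge, so a new conflict can occur only at `s`.
  addLeaf-proper : ∀ {col} → IsTreeIn G U T E → t ∉ T → ProperEdges col E →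
                   (∀ w → E s w ≡ true → col s w ≢ col s t) → ProperEdges col (addEdge s t E)
  addLeaf-proper tr t∉T proper avoid u v w uv uw v≢w with addEdge⁻ s t E u v uv | addEdge⁻ s t E u w uw
  ... | inj₁ a                  | inj₁ b                  = proper u v w a b v≢w
  ... | inj₁ a                  | inj₂ (inj₁ (refl , refl)) = avoid v a
  ... | inj₂ (inj₁ (refl , refl)) | inj₁ b                = λ e → avoid w b (≡.sym e)
  ... | inj₂ (inj₂ (refl , refl)) | _ = contradiction (≡.sym (leaf-nbr tr t∉T uw)) v≢w
  ... | _ | inj₂ (inj₂ (refl , refl)) = contradiction (leaf-nbr tr t∉T uv) v≢w
  ... | inj₂ (inj₁ (refl , refl)) | inj₂ (inj₁ (_ , refl)) = contradiction refl v≢w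

-- Three classes and partial colourings

-- The values third i i are junk.
third : Fin 3 → Fin 3 → Fin 3
third 0F 0F = 0F
third 0F 1F = 2F
third 0F 2F = 1F
third 1F 0F = 2F
third 1F 1F = 1F
third 1F 2F = 0F
third 2F 0F = 1F
third 2F 1F = 0F
third 2F 2F = 2F

third-comm : ∀ i j → third i j ≡ third j i
third-comm = toWitness {a? = all? λ i → all? λ j → third i j ≟ third j i} tt

third-unique : ∀ i j k → i ≢ j → i ≢ k → j ≢ k → third i j ≡ k
third-unique = toWitness
  {a? = all? λ i → all? λ j → all? λ k → ¬? (i ≟ j) →-dec ¬? (i ≟ k) →-dec ¬? (j ≟ k) →-dec (third i j ≟ k)} tt

third≢ˡ : ∀ i j → i ≢ j → third i j ≢ i
third≢ˡ = toWitness {a? = all? λ i → all? λ j → ¬? (i ≟ j) →-dec ¬? (third i j ≟ i)} tt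

third≢ʳ : ∀ i j → i ≢ j → third i j ≢ j
third≢ʳ i j i≢j e = third≢ˡ j i (≢-sym i≢j) (trans (third-comm j i) e)

Distinct : Fin 3 → Fin 3 → Fin 3 → Set
Distinct i j k = i ≢ j × i ≢ k × j ≢ k

third-distinct : ∀ {i j} → i ≢ j → Distinct (third i j) i j
third-distinct {i} {j} i≢j = third≢ˡ i j i≢j , third≢ʳ i j i≢j , i≢j

Partial : ℕ → Set
Partial n = Fin n → Maybe (Fin 3)

abstract
  update : ∀ {A : Set} → Fin n → A → (Fin n → A) → Fin n → A
  update h a f x with x ≟ h
  ... | yes _ = a
  ... | no  _ = f x

  update-at : ∀ {A : Set} h (a : A) (f : Fin n → A) → update h a f h ≡ a
  update-at h a f with h ≟ h
  ... | yes _  = refl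
  ... | no h≢h = contradiction refl h≢h

  update-other : ∀ {A : Set} h (a : A) (f : Fin n → A) {x} → x ≢ h → update h a f x ≡ f x
  update-other h a f {x} x≢h with x ≟ h
  ... | yes x≡h = contradiction x≡h x≢h
  ... | no _    = refl

set : Fin n → Fin 3 → Partial n → Partial n
set h c = update h (just c)

_⊑_ : Partial n → Partial n → Set
κ ⊑ κ′ = ∀ {x c} → κ x ≡ just c → κ′ x ≡ just c

just≢nothing : ∀ {A : Set} {m : Maybe A} {a} → m ≡ just a → m ≢ nothing
just≢nothing refl ()

coloured? : ∀ (κ : Partial n) x → Dec (∃[ i ] κ x ≡ just i)
coloured? κ x with κ x
... | just i  = yes (i , refl)
... | nothing = no λ ()

uncoloured : ∀ {m : Maybe (Fin 3)} → ¬ (∃[ i ] m ≡ just i) → m ≡ nothing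
uncoloured {just i}  ∄i = contradiction (i , refl) ∄i
uncoloured {nothing} _  = refl

Edge⇒≢ : ∀ (G : Graph n) {u v} → Edge G u v → u ≢ v
Edge⇒≢ G {u} uv refl with () ← trans (≡.sym uv) (irrefl G u)

-- Measure for the termination of the greedy process. It counts `D` as well, which stays uncoloured;
-- only the decrease matters.
pending : Partial n → ℕ
pending κ = ∣ tabulate (λ x → is-nothing (κ x)) ∣

module _ (κ : Partial n) (h : Fin n) (c : Fin 3) where

  set-at : set h c κ h ≡ just c
  set-at = update-at h (just c) κ

  set-other : ∀ {x} → x ≢ h → set h c κ x ≡ κ x
  set-other = update-other h (just c) κ

  set-⊒ : κ h ≡ nothing → κ ⊑ set h c κ
  set-⊒ κh κx = trans (set-other λ { refl → just≢nothing κx κh }) κx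

  set⁻ : ∀ {x i} → set h c κ x ≡ just i → (x ≡ h × c ≡ i) ⊎ κ x ≡ just i
  set⁻ {x} e with x ≟ h
  ... | yes refl = inj₁ (refl , just-injective (trans (≡.sym set-at) e))
  ... | no x≢h   = inj₂ (trans (≡.sym (set-other x≢h)) e)

  pending-set : κ h ≡ nothing → pending (set h c κ) < pending κ
  pending-set κh = p⊂q⇒∣p∣<∣q∣
    ( (λ x∈ → ∈-tabulate⁺ _ (still (∈-tabulate⁻ _ x∈)))
    , h , ∈-tabulate⁺ _ (cong is-nothing κh) , h∉ )
    where
    h∉ : h ∉ tabulate (λ x → is-nothing (set h c κ x))
    h∉ h∈ with () ← trans (≡.sym (cong is-nothing set-at)) (∈-tabulate⁻ _ h∈)

    still : ∀ {x} → is-nothing (set h c κ x) ≡ true → is-nothing (κ x) ≡ true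
    still {x} e with x ≟ h
    ... | yes refl = cong is-nothing κh
    ... | no x≢h   = trans (≡.sym (cong is-nothing (set-other x≢h))) e

-- The partition into three classes

-- In Good and Half below, i is the class of v.
module Partition (G : Graph n) (D : Subset n)
                 (foot : Fin n → Fin n)
                 (deg : ∀ v → v ∉ D → 3 ≤ degree G v) where

  data Good (κ : Partial n) (v : Fin n) (i : Fin 3) : Set where
    rich    : ∀ {a b j k} → Edge G v a → Edge G v b → κ a ≡ just j → κ b ≡ just k →
              Distinct i j k → Good κ v i
    -- The third class is reached by way of `a` and `w`; the twin `b` is kept for the case that
    -- another route runs through `a`.
    poor    : ∀ {a b w j k} → a ≢ b → Edge G v a → Edge G v b → Edge G a w →
              κ a ≡ just j → κ b ≡ just j → κ w ≡ just k → Distinct i j k → Good κ v i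
    -- Since `f` is not the foot, this leg is free to take the third class as its colour.
    oneLeg  : ∀ {a f j} → Edge G v a → κ a ≡ just j → i ≢ j →
              f ∈ D → f ≢ foot v → Edge G v f → Good κ v i
    -- Two extra legs would be enough here, but otherClassNbr needs that a good vertex without a neighbour of
    -- another class has no uncoloured neighbour outside D.
    allLegs : (∀ w → Edge G v w → w ∈ D) → Good κ v i

  record Half (κ : Partial n) (v : Fin n) (i : Fin 3) : Set where
    constructor half
    field
      {b w} : Fin n
      {j k} : Fin 3
      vb    : Edge G v b
      bw    : Edge G b w
      κb    : κ b ≡ just j
      κw    : κ w ≡ just k
      dist  : Distinct i j k

  Open : Partial n → Fin n → Set
  Open κ h = h ∉ D × κ h ≡ nothing

  -- v becomes good as soon as an open neighbour of v receives a class other than its own.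
  Owed : Partial n → Fin n → Fin 3 → Set
  Owed κ v i = Half κ v i × ∃[ h ] (Open κ h × Edge G v h)

  Good-mono : ∀ {κ κ′ v i} → κ ⊑ κ′ → Good κ v i → Good κ′ v i
  Good-mono κ⊑ (rich va vb κa κb d)          = rich va vb (κ⊑ κa) (κ⊑ κb) d
  Good-mono κ⊑ (poor a≢b va vb aw κa κb κw d) = poor a≢b va vb aw (κ⊑ κa) (κ⊑ κb) (κ⊑ κw) d
  Good-mono κ⊑ (oneLeg va κa i≢j f∈ f≢ vf)   = oneLeg va (κ⊑ κa) i≢j f∈ f≢ vf
  Good-mono κ⊑ (allLegs v⊆D)                 = allLegs v⊆D

  Half-mono : ∀ {κ κ′ v i} → κ ⊑ κ′ → Half κ v i → Half κ′ v i
  Half-mono κ⊑ (half vb bw κb κw d) = half vb bw (κ⊑ κb) (κ⊑ κw) d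

  -- If `h` receives the class of `b`, then `b` and `h` are the twins of `poor`, with `w` behind
  -- `b`; if it receives the remaining class, `b` and `h` make `v` rich.
  settle : ∀ {κ κ′ v i h c} → κ ⊑ κ′ → Half κ v i → κ h ≡ nothing → κ′ h ≡ just c →
           Edge G v h → i ≢ c → Good κ′ v i
  settle {i = i} {h} {c} κ⊑ (half {b} {w} {j} {k} vb bw κb κw d@(i≢j , i≢k , j≢k)) κh κ′h vh i≢c with c ≟ j
  ... | yes refl = poor (λ { refl → just≢nothing κb κh }) vb vh bw (κ⊑ κb) κ′h (κ⊑ κw) d
  ... | no c≢j   = rich vb vh (κ⊑ κb) κ′h (i≢j , i≢c , ≢-sym c≢j)

  -- A vertex about to be coloured has to avoid the classes of its owed neighbours; with at most two of them
  -- there is always a class left.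
  record State (κ : Partial n) (o₁ o₂ : Fin n) : Set where
    field
      avoidsD : ∀ {x i} → κ x ≡ just i → x ∉ D
      status  : ∀ {x i} → κ x ≡ just i → Good κ x i ⊎ ((x ≡ o₁ ⊎ x ≡ o₂) × Owed κ x i)

  -- Prolonging the walk by one vertex

  port : ∀ v → v ∉ D → ∀ a → ∃[ w ] (Edge G v w × w ≢ a × w ≢ foot v)
  port v v∉D a = avoidTwo G (deg v v∉D) a (foot v)

  -- Neighbours of different classes make `h` rich in the third one. If both have class `i`, they
  -- are twins, `b` lies behind `p`, and `h` takes the class other than `i` and `d`.
  twoNbrs : ∀ {κ h p q i j b d} → p ≢ q → Edge G h p → Edge G h q → κ p ≡ just i → κ q ≡ just j →
            Edge G p b → κ b ≡ just d → i ≢ d →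
            ∃[ c ] (i ≢ c × j ≢ c × Good κ h c)
  twoNbrs {i = i} {j} {d = d} p≢q hp hq κp κq pb κb i≢d with i ≟ j
  ... | yes refl = third i d , ≢-sym (third≢ˡ i d i≢d) , ≢-sym (third≢ˡ i d i≢d) ,
                   poor p≢q hp hq pb κp κq κb (third-distinct i≢d)
  ... | no i≢j   = third i j , ≢-sym (third≢ˡ i j i≢j) , ≢-sym (third≢ʳ i j i≢j) ,
                   rich hp hq κp κq (third-distinct i≢j)

  module _ {κ : Partial n} {p o h : Fin n} {i : Fin 3} (st : State κ p o)
           (κp : κ p ≡ just i) (h-open : Open κ h) (ph : Edge G p h) where

    open State st

    private
      h∉D = proj₁ h-open
      κh  = proj₂ h-open
      hp  = Edge-sym G ph

    -- Provides the continuation behind `p` that `h` needs in order to be poor or half by way of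
    -- `p`.
    otherClassNbr : ∃₂ λ b d → Edge G p b × κ b ≡ just d × i ≢ d
    otherClassNbr with status κp
    ... | inj₁ (rich va _ κa _ (i≢j , _))          = _ , _ , va , κa , i≢j
    ... | inj₁ (poor _ va _ _ κa _ _ (i≢j , _))    = _ , _ , va , κa , i≢j
    ... | inj₁ (oneLeg va κa i≢j _ _ _)            = _ , _ , va , κa , i≢j
    ... | inj₁ (allLegs v⊆D)                       = contradiction (v⊆D h ph) h∉D
    ... | inj₂ (_ , half vb _ κb _ (i≢j , _) , _)  = _ , _ , vb , κb , i≢j

    -- If `p` is owed, `h` settles it, so `h` can take its place in the pair. The vertex `o` stays
    -- owed when its open neighbour is not `h`; otherwise `avoids`, or `i ≢ c` if `o` is `p`, lets
    -- `h` settle it too.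
    paint : ∀ c → i ≢ c → (∀ {j} → κ o ≡ just j → Edge G o h → o ≢ p → j ≢ c) →
            Good (set h c κ) h c ⊎ Owed (set h c κ) h c → State (set h c κ) h o
    paint c i≢c avoids h-status = record { avoidsD = avoidsD′ ; status = status′ }
      where
      κ′ = set h c κ
      κ⊑ : κ ⊑ κ′
      κ⊑ = set-⊒ κ h c κh

      avoidsD′ : ∀ {x i} → κ′ x ≡ just i → x ∉ D
      avoidsD′ κ′x with set⁻ κ h c κ′x
      ... | inj₁ (refl , _) = h∉D
      ... | inj₂ κx         = avoidsD κx

      old : ∀ {x i} → κ x ≡ just i → Good κ′ x i ⊎ ((x ≡ h ⊎ x ≡ o) × Owed κ′ x i)
      old {x} κx with status κx
      ... | inj₁ g = inj₁ (Good-mono κ⊑ g)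
      ... | inj₂ (inj₁ refl , hf , _) =
            inj₁ (settle κ⊑ hf κh (set-at κ h c) ph (subst (_≢ c) (just-injective (trans (≡.sym κp) κx)) i≢c))
      ... | inj₂ (inj₂ refl , hf , h′ , (h′∉D , κh′) , xh′) with h′ ≟ h
      ...   | no h′≢h = inj₂ (inj₂ refl , Half-mono κ⊑ hf , h′ , (h′∉D , trans (set-other κ h c h′≢h) κh′) , xh′)
      ...   | yes refl with x ≟ p
      ...     | yes refl = inj₁ (settle κ⊑ hf κh (set-at κ h c) ph (subst (_≢ c) (just-injective (trans (≡.sym κp) κx)) i≢c))
      ...     | no x≢p   = inj₁ (settle κ⊑ hf κh (set-at κ h c) xh′ (avoids κx xh′ x≢p))

      status′ : ∀ {x i} → κ′ x ≡ just i → Good κ′ x i ⊎ ((x ≡ h ⊎ x ≡ o) × Owed κ′ x i)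
      status′ κ′x with set⁻ κ h c κ′x
      ... | inj₁ (refl , refl) = Sum.map₂ (inj₁ refl ,_) h-status
      ... | inj₂ κx            = old κx

    -- A coloured neighbour `o` of `h` comes first, because its class must be avoided together with
    -- that of `p`. Otherwise only `p` matters and a further edge `hq` decides: an extra leg gives
    -- `oneLeg`, a coloured `q` gives `twoNbrs`, and an open `q` leaves `h` owed, with `p` and `b`
    -- as its half.
    advance : ∃[ c ] State (set h c κ) h o
    advance with otherClassNbr | coloured? κ o ×-dec (adj G o h ≟ᵇ true) ×-dec ¬? (o ≟ p)
    ... | b , d , pb , κb , i≢d | yes ((j , κo) , oh , o≢p)
        with twoNbrs (≢-sym o≢p) hp (Edge-sym G oh) κp κo pb κb i≢d
    ...   | c , i≢c , j≢c , g =
            c , paint c i≢c (λ κo′ _ _ → subst (_≢ c) (just-injective (trans (≡.sym κo) κo′)) j≢c)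
                      (inj₁ (Good-mono (set-⊒ κ h c κh) g))
    advance | b , d , pb , κb , i≢d | no noRival with port h h∉D p
    ... | q , hq , q≢p , q≢foot with q ∈? D | coloured? κ q
    ...   | yes q∈D | _ = c , paint c (≢-sym c≢i) (λ κo oh o≢p → contradiction ((_ , κo) , oh , o≢p) noRival)
                                  (inj₁ (oneLeg hp (set-⊒ κ h c κh κp) c≢i q∈D q≢foot hq))
      where
      -- Any class other than `i` would do here.
      c   = third i d
      c≢i = third≢ˡ i d i≢d
    ...   | no _ | yes (j , κq) with twoNbrs (≢-sym q≢p) hp hq κp κq pb κb i≢d
    ...     | c , i≢c , _ , g =
              c , paint c i≢c (λ κo oh o≢p → contradiction ((_ , κo) , oh , o≢p) noRival)
                        (inj₁ (Good-mono (set-⊒ κ h c κh) g))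
    advance | b , d , pb , κb , i≢d | no noRival | q , hq , q≢p , q≢foot | no q∉D | no q-plain =
      c , paint c (≢-sym (third≢ˡ i d i≢d)) (λ κo oh o≢p → contradiction ((_ , κo) , oh , o≢p) noRival)
            (inj₂ (Half-mono (set-⊒ κ h c κh) (half hp pb κp κb (third-distinct i≢d)) ,
                   q , (q∉D , trans (set-other κ h c (Edge⇒≢ G (Edge-sym G hq))) (uncoloured q-plain)) , hq))
      where
      c = third i d

  State-swap : ∀ {κ o₁ o₂} → State κ o₁ o₂ → State κ o₂ o₁
  State-swap st = record
    { avoidsD = State.avoidsD st
    ; status  = λ κx → Sum.map₂ (λ (e , w) → Sum.swap e , w) (State.status st κx)
    }

  -- Seeding a new walk

  Progress : Partial n → Set
  Progress κ = ∃[ κ′ ] ∃[ o₁ ] ∃[ o₂ ] (State κ′ o₁ o₂ × pending κ′ < pending κ)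

  -- Meant for the ends of a freshly coloured path `u`, `m`, `w`. A further edge at `u` is an extra
  -- leg, closes a triangle with `w`, or leads to an uncoloured vertex, and then `u` is owed.
  endStatus : ∀ {κ u m w i j k} → u ∉ D → Edge G u m → Edge G m w → κ m ≡ just j → κ w ≡ just k →
              Distinct i j k → (∀ {x} → x ∉ D → Edge G u x → x ≢ m → x ≢ w → κ x ≡ nothing) →
              Good κ u i ⊎ Owed κ u i
  endStatus {u = u} {m} {w} u∉D um mw κm κw dist@(i≢j , _) plain with port u u∉D m
  ... | p , up , p≢m , p≢foot with p ∈? D | p ≟ w
  ...   | yes p∈D | _        = inj₁ (oneLeg um κm i≢j p∈D p≢foot up)
  ...   | no _    | yes refl = inj₁ (rich um up κm κw dist)
  ...   | no p∉D  | no p≢w   = inj₂ (half um mw κm κw dist , p , (p∉D , plain p∉D up p≢m p≢w) , up)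

  -- The walk has to start afresh: no vertex still to be coloured has a coloured neighbour.
  module _ {κ : Partial n}
           (avoidsD : ∀ {x i} → κ x ≡ just i → x ∉ D)
           (good : ∀ {x i} → κ x ≡ just i → Good κ x i)
           (isolated : ∀ {h p i} → Open κ h → κ p ≡ just i → ¬ Edge G p h) where

    private
      openNbr : ∀ {h x} → Open κ h → x ∉ D → Edge G h x → Open κ x
      openNbr {h} {x} h-open x∉D hx =
        x∉D , uncoloured λ (_ , κx) → isolated h-open κx (Edge-sym G hx)

      -- The middle vertex is rich at once; the two ends are the vertices that may be owed.
      seedTriple : ∀ {v₁ v₂ v₃} → Open κ v₁ → Open κ v₂ → Open κ v₃ →
                   Edge G v₁ v₂ → Edge G v₂ v₃ → v₁ ≢ v₃ → Progress κ
      seedTriple {v₁} {v₂} {v₃} op₁ op₂ op₃ e₁₂ e₂₃ v₁≢v₃ =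
        κ₃ , v₁ , v₃ , record { avoidsD = avoidsD₃ ; status = status₃ } ,
        <-trans (pending-set κ₂ v₃ 2F κ₂v₃)
          (<-trans (pending-set κ₁ v₂ 1F κ₁v₂) (pending-set κ v₁ 0F (proj₂ op₁)))
        where
        κ₁ = set v₁ 0F κ
        κ₂ = set v₂ 1F κ₁
        κ₃ = set v₃ 2F κ₂

        v₁≢v₂ = Edge⇒≢ G e₁₂
        v₂≢v₃ = Edge⇒≢ G e₂₃

        plain : ∀ {x} → x ≢ v₁ → x ≢ v₂ → x ≢ v₃ → κ x ≡ nothing → κ₃ x ≡ nothing
        plain a b c κx = trans (set-other κ₂ v₃ 2F c) (trans (set-other κ₁ v₂ 1F b) (trans (set-other κ v₁ 0F a) κx))

        κ₁v₂ : κ₁ v₂ ≡ nothing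
        κ₁v₂ = trans (set-other κ v₁ 0F (≢-sym v₁≢v₂)) (proj₂ op₂)

        κ₂v₃ : κ₂ v₃ ≡ nothing
        κ₂v₃ = trans (set-other κ₁ v₂ 1F (≢-sym v₂≢v₃)) (trans (set-other κ v₁ 0F (≢-sym v₁≢v₃)) (proj₂ op₃))

        κ⊑κ₃ : κ ⊑ κ₃
        κ⊑κ₃ e = set-⊒ κ₂ v₃ 2F κ₂v₃ (set-⊒ κ₁ v₂ 1F κ₁v₂ (set-⊒ κ v₁ 0F (proj₂ op₁) e))

        κ₃v₁ : κ₃ v₁ ≡ just 0F
        κ₃v₁ = set-⊒ κ₂ v₃ 2F κ₂v₃ (set-⊒ κ₁ v₂ 1F κ₁v₂ (set-at κ v₁ 0F))

        κ₃v₂ : κ₃ v₂ ≡ just 1F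
        κ₃v₂ = set-⊒ κ₂ v₃ 2F κ₂v₃ (set-at κ₁ v₂ 1F)

        κ₃v₃ : κ₃ v₃ ≡ just 2F
        κ₃v₃ = set-at κ₂ v₃ 2F

        cases : ∀ {x i} → κ₃ x ≡ just i → (x ≡ v₃ × 2F ≡ i) ⊎ (x ≡ v₂ × 1F ≡ i) ⊎ (x ≡ v₁ × 0F ≡ i) ⊎ κ x ≡ just i
        cases e with set⁻ κ₂ v₃ 2F e
        ... | inj₁ at₃ = inj₁ at₃
        ... | inj₂ e′ with set⁻ κ₁ v₂ 1F e′
        ...   | inj₁ at₂ = inj₂ (inj₁ at₂)
        ...   | inj₂ e″  = inj₂ (inj₂ (set⁻ κ v₁ 0F e″))

        avoidsD₃ : ∀ {x i} → κ₃ x ≡ just i → x ∉ D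
        avoidsD₃ e with cases e
        ... | inj₁ (refl , _)               = proj₁ op₃
        ... | inj₂ (inj₁ (refl , _))        = proj₁ op₂
        ... | inj₂ (inj₂ (inj₁ (refl , _))) = proj₁ op₁
        ... | inj₂ (inj₂ (inj₂ κx))         = avoidsD κx

        status₃ : ∀ {x i} → κ₃ x ≡ just i → Good κ₃ x i ⊎ ((x ≡ v₁ ⊎ x ≡ v₃) × Owed κ₃ x i)
        status₃ e with cases e
        ... | inj₁ (refl , refl) =
              Sum.map₂ (inj₂ refl ,_)
                (endStatus (proj₁ op₃) (Edge-sym G e₂₃) (Edge-sym G e₁₂) κ₃v₂ κ₃v₁ ((λ ()) , (λ ()) , λ ())
                  λ x∉D vx x≢v₂ x≢v₁ → plain x≢v₁ x≢v₂ (≢-sym (Edge⇒≢ G vx)) (proj₂ (openNbr op₃ x∉D vx)))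
        ... | inj₂ (inj₁ (refl , refl)) =
              inj₁ (rich (Edge-sym G e₁₂) e₂₃ κ₃v₁ κ₃v₃ ((λ ()) , (λ ()) , λ ()))
        ... | inj₂ (inj₂ (inj₁ (refl , refl))) =
              Sum.map₂ (inj₁ refl ,_)
                (endStatus (proj₁ op₁) e₁₂ e₂₃ κ₃v₂ κ₃v₃ ((λ ()) , (λ ()) , λ ())
                  λ x∉D vx x≢v₂ x≢v₃ → plain (≢-sym (Edge⇒≢ G vx)) x≢v₂ x≢v₃ (proj₂ (openNbr op₁ x∉D vx)))
        ... | inj₂ (inj₂ (inj₂ κx)) = inj₁ (Good-mono κ⊑κ₃ (good κx))

      -- Each of the two vertices has an extra leg and serves the other as neighbour of another
      -- class.
      seedPair : ∀ {v₁ v₂ p r} → Open κ v₁ → Open κ v₂ → Edge G v₁ v₂ →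
                 p ∈ D → p ≢ foot v₁ → Edge G v₁ p → r ∈ D → r ≢ foot v₂ → Edge G v₂ r → Progress κ
      seedPair {v₁} {v₂} op₁ op₂ e₁₂ p∈D p≢ v₁p r∈D r≢ v₂r =
        -- Nothing is owed, so `v₁` merely fills both places.
        κ₂ , v₁ , v₁ , record { avoidsD = avoidsD₂ ; status = λ e → inj₁ (status₂ e) } ,
        <-trans (pending-set κ₁ v₂ 1F κ₁v₂) (pending-set κ v₁ 0F (proj₂ op₁))
        where
        κ₁ = set v₁ 0F κ
        κ₂ = set v₂ 1F κ₁

        κ₁v₂ : κ₁ v₂ ≡ nothing
        κ₁v₂ = trans (set-other κ v₁ 0F (≢-sym (Edge⇒≢ G e₁₂))) (proj₂ op₂)

        κ₂v₁ : κ₂ v₁ ≡ just 0F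
        κ₂v₁ = set-⊒ κ₁ v₂ 1F κ₁v₂ (set-at κ v₁ 0F)

        avoidsD₂ : ∀ {x i} → κ₂ x ≡ just i → x ∉ D
        avoidsD₂ e with set⁻ κ₁ v₂ 1F e
        ... | inj₁ (refl , _) = proj₁ op₂
        ... | inj₂ e′ with set⁻ κ v₁ 0F e′
        ...   | inj₁ (refl , _) = proj₁ op₁
        ...   | inj₂ κx         = avoidsD κx

        status₂ : ∀ {x i} → κ₂ x ≡ just i → Good κ₂ x i
        status₂ e with set⁻ κ₁ v₂ 1F e
        ... | inj₁ (refl , refl) = oneLeg (Edge-sym G e₁₂) κ₂v₁ (λ ()) r∈D r≢ v₂r
        ... | inj₂ e′ with set⁻ κ v₁ 0F e′
        ...   | inj₁ (refl , refl) = oneLeg e₁₂ (set-at κ₁ v₂ 1F) (λ ()) p∈D p≢ v₁p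
        ...   | inj₂ κx = Good-mono (λ c → set-⊒ κ₁ v₂ 1F κ₁v₂ (set-⊒ κ v₁ 0F (proj₂ op₁) c)) (good κx)

      seedSingle : ∀ {v} → Open κ v → (∀ w → Edge G v w → w ∈ D) → Progress κ
      seedSingle {v} op v⊆D =
        set v 0F κ , v , v , record { avoidsD = avoidsD₁ ; status = λ e → inj₁ (status₁ e) } ,
        pending-set κ v 0F (proj₂ op)
        where
        avoidsD₁ : ∀ {x i} → set v 0F κ x ≡ just i → x ∉ D
        avoidsD₁ e with set⁻ κ v 0F e
        ... | inj₁ (refl , _) = proj₁ op
        ... | inj₂ κx         = avoidsD κx

        status₁ : ∀ {x i} → set v 0F κ x ≡ just i → Good (set v 0F κ) x i
        status₁ e with set⁻ κ v 0F e
        ... | inj₁ (refl , _) = allLegs v⊆D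
        ... | inj₂ κx         = Good-mono (set-⊒ κ v 0F (proj₂ op)) (good κx)

    -- If `v` has a neighbour `w` outside `D`, a further edge is taken at each of the two. Either
    -- both are extra legs, or one of them prolongs the edge `vw` to a path on three open vertices.
    seed : ∀ {v} → Open κ v → Progress κ
    seed {v} op with any? (λ w → ¬? (w ∈? D) ×-dec (adj G v w ≟ᵇ true))
    ... | no ∄w = seedSingle op λ w vw → decidable-stable (w ∈? D) λ w∉D → ∄w (w , w∉D , vw)
    ... | yes (w , w∉D , vw) with openNbr op w∉D vw
    ...   | op′ with port v (proj₁ op) w | port w w∉D v
    ...     | p , vp , p≢w , p≢foot | r , wr , r≢v , r≢foot with p ∈? D | r ∈? D
    ...       | yes p∈D | yes r∈D = seedPair op op′ vw p∈D p≢foot vp r∈D r≢foot wr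
    ...       | _       | no r∉D  = seedTriple op op′ (openNbr op′ r∉D wr) vw wr (≢-sym r≢v)
    ...       | no p∉D  | yes _   = seedTriple op′ op (openNbr op p∉D vp) (Edge-sym G vw) vp (≢-sym p≢w)

  Total : Set
  Total = ∃[ κ ] ((∀ v → v ∉ D → ∃[ i ] κ v ≡ just i) ×
                  (∀ {v i} → κ v ≡ just i → v ∉ D × Good κ v i))

  -- Running the greedy process

  private
    open? : ∀ κ h → Dec (Open κ h)
    open? κ h = ¬? (h ∈? D) ×-dec Dec.map′ uncoloured (λ κh (_ , κx) → just≢nothing κx κh) (¬? (coloured? κ h))

    frontier? : ∀ κ p → Dec (∃[ h ] ((∃[ i ] κ p ≡ just i) × Open κ h × Edge G p h))
    frontier? κ p = any? λ h → coloured? κ p ×-dec open? κ h ×-dec (adj G p h ≟ᵇ true)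

    progress : ∀ {κ p o h i} → State κ p o → κ p ≡ just i → Open κ h → Edge G p h → Progress κ
    progress {κ} {o = o} {h} st κp op ph with advance st κp op ph
    ... | c , st′ = set h c κ , h , o , st′ , pending-set κ h c (proj₂ op)

    -- An owed vertex has an open neighbour, so once neither `o₁` nor `o₂` has one, every coloured
    -- vertex is good. The walk may then resume at any coloured vertex with an open neighbour, or be
    -- seeded afresh where there is none.
    iterate : ∀ {κ o₁ o₂} → State κ o₁ o₂ → Progress κ ⊎ Total
    iterate {κ} {o₁} {o₂} st with frontier? κ o₁ | frontier? κ o₂
    ... | yes (h , (i , κp) , op , ph) | _ = inj₁ (progress st κp op ph)
    ... | no _ | yes (h , (i , κp) , op , ph) = inj₁ (progress (State-swap st) κp op ph)
    ... | no ∄₁ | no ∄₂ = allGood λ κx → good κx (status κx)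
      where
      open State st
      good : ∀ {x i} → κ x ≡ just i → Good κ x i ⊎ ((x ≡ o₁ ⊎ x ≡ o₂) × Owed κ x i) → Good κ x i
      good κx (inj₁ g) = g
      good κx (inj₂ (inj₁ refl , _ , h , op , xh)) = contradiction (h , (_ , κx) , op , xh) ∄₁
      good κx (inj₂ (inj₂ refl , _ , h , op , xh)) = contradiction (h , (_ , κx) , op , xh) ∄₂

      allGood : (∀ {x i} → κ x ≡ just i → Good κ x i) → Progress κ ⊎ Total
      allGood good with any? (frontier? κ)
      ... | yes (p , h , (i , κp) , op , ph) =
            inj₁ (progress {o = p} (record { avoidsD = avoidsD ; status = λ e → inj₁ (good e) }) κp op ph)
      ... | no ∄p with any? (open? κ)
      ...   | yes (v , op) = inj₁ (seed avoidsD good (λ op κp ph → ∄p (_ , _ , (_ , κp) , op , ph)) op)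
      ...   | no ∄v = inj₂ (κ , (λ v v∉D → decidable-stable (coloured? κ v) λ ∄i → ∄v (v , v∉D , uncoloured ∄i)) ,
                            λ κv → avoidsD κv , good κv)

    run : ∀ m {κ o₁ o₂} → State κ o₁ o₂ → pending κ ≤ m → Total
    run m st ≤m with iterate st
    run m       st ≤m | inj₂ total = total
    run zero    st ≤m | inj₁ (_ , _ , _ , _ , lt) = contradiction (≤-trans lt ≤m) λ ()
    run (suc m) st ≤m | inj₁ (_ , _ , _ , st′ , lt) = run m st′ (≤-pred (≤-trans lt ≤m))

  partition : Fin n → Total
  partition o = run _ {λ _ → nothing} {o} {o} (record { avoidsD = λ () ; status = λ () }) ≤-refl

-- Colours available to a vertex outside `D`

next : Fin 3 → Fin 3
next 0F = 1F
next 1F = 2F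
next 2F = 0F

next≢ : ∀ i → next i ≢ i
next≢ 0F ()
next≢ 1F ()
next≢ 2F ()

module _ (G : Graph n) (D : Subset n) (cl : Fin n → Fin 3) where

  -- Either way `v` can hang from `D` by a leg of colour `j`: its own, or the main leg of `a`.
  Step : Fin n → (Fin n → Fin 3) → Fin 3 → Set
  Step v leg j = (∃[ f ] (f ∈ D × Edge G v f × leg f ≡ j)) ⊎ (∃[ a ] (a ∉ D × Edge G v a × cl a ≡ j))

  record Poor (v : Fin n) : Set where
    constructor mkPoor
    field
      {a b w}   : Fin n
      a∉D       : a ∉ D
      b∉D       : b ∉ D
      w∉D       : w ∉ D
      a≢b       : a ≢ b
      va        : Edge G v a
      vb        : Edge G v b
      aw        : Edge G a w
      sameClass : cl a ≡ cl b
      dist      : Distinct (cl v) (cl a) (cl w)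

  -- The cases `rich`, `oneLeg` and `allLegs` merge into the first alternative; only `poor` needs a
  -- treatment of its own.
  Reaching : Fin n → Fin n → (Fin n → Fin 3) → Set
  Reaching v foot leg = leg foot ≡ cl v × ((∀ j → j ≢ cl v → Step v leg j) ⊎ Poor v)

module _ (G : Graph n) (D : Subset n) (foot : Fin n → Fin n)
         (deg : ∀ v → v ∉ D → 3 ≤ degree G v) where

  open Partition G D foot deg

  reaching : Fin n → ∃[ cl ] (∀ v → v ∉ D → ∃[ leg ] Reaching G D cl v (foot v) leg)
  reaching o with partition o
  ... | κ , total , good = cl , λ v v∉D → reach v∉D (proj₂ (good (κ≡cl v v∉D)))
    where
    cl : Fin n → Fin 3
    cl v with κ v
    ... | just i  = i
    -- The default reaches only vertices of `D`, whose class enters no colour.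
    ... | nothing = 0F

    κ-cl : ∀ {v i} → κ v ≡ just i → cl v ≡ i
    κ-cl {v} e with just i ← κ v = just-injective e

    κ≡cl : ∀ v → v ∉ D → κ v ≡ just (cl v)
    κ≡cl v v∉D with total v v∉D
    ... | i , κv = trans κv (cong just (≡.sym (κ-cl κv)))

    via : ∀ {v a j leg} → Edge G v a → κ a ≡ just j → Step G D cl v leg j
    via va κa = inj₂ (_ , proj₁ (good κa) , va , κ-cl κa)

    twoSteps : ∀ {P : Fin 3 → Set} {i j} → i ≢ j → P j → P (third i j) → ∀ k → k ≢ i → P k
    twoSteps {P} {i} {j} i≢j pj pt k k≢i with j ≟ k
    ... | yes refl = pj
    ... | no j≢k   = subst P (third-unique i j k i≢j (≢-sym k≢i) j≢k) pt

    reach : ∀ {v} → v ∉ D → Good κ v (cl v) → ∃[ leg ] Reaching G D cl v (foot v) leg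
    reach {v} v∉D (rich {j = j} {k} va vb κa κb (i≢j , i≢k , j≢k)) =
      (λ _ → cl v) , refl , inj₁ (twoSteps i≢j (via va κa)
        (via vb (trans κb (cong just (≡.sym (third-unique (cl v) j k i≢j i≢k j≢k))))))
    reach {v} v∉D (poor a≢b va vb aw κa κb κw dist) =
      (λ _ → cl v) , refl , inj₂ (mkPoor (proj₁ (good κa)) (proj₁ (good κb)) (proj₁ (good κw)) a≢b va vb aw
        (trans (κ-cl κa) (≡.sym (κ-cl κb)))
        (subst (λ j → Distinct (cl v) j _) (≡.sym (κ-cl κa)) (subst (Distinct (cl v) _) (≡.sym (κ-cl κw)) dist)))
    reach {v} v∉D (oneLeg {f = f} {j} va κa i≢j f∈D f≢foot vf) =
      -- The extra leg gets the class that neither `v` nor `a` has; all other legs, the main one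
      -- included, keep the class of `v`.
      update f (third (cl v) j) (λ _ → cl v) , update-other _ _ _ (≢-sym f≢foot) ,
      inj₁ (twoSteps i≢j (via va κa) (inj₁ (f , f∈D , vf , update-at _ _ _)))
    reach {v} v∉D (allLegs v⊆D) with port v v∉D (foot v)
    ... | f , vf , f≢foot , _ with port v v∉D f
    ...   | g , vg , g≢f , g≢foot =
      -- The legs to `f` and `g`, which differ from the foot and from each other, carry the two
      -- other classes.
      update f (next (cl v)) (update g (third (cl v) (next (cl v))) λ _ → cl v) ,
      trans (update-other _ _ _ (≢-sym f≢foot)) (update-other _ _ _ (≢-sym g≢foot)) ,
      inj₁ (twoSteps (≢-sym (next≢ (cl v))) (inj₁ (f , v⊆D f vf , vf , update-at _ _ _))
        (inj₁ (g , v⊆D g vg , vg , trans (update-other _ _ _ g≢f) (update-at _ _ _))))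

-- The colouring and its trees

module Extension
  (G : Graph n) (D : Subset n) {q : ℕ} {colD : Fin n → Fin n → ℕ}
  (isCol : IsColoring G D q colD) (3-proper : KProper G D 3 colD)
  (foot : Fin n → Fin n) (foot∈D : ∀ v → v ∉ D → foot v ∈ D) (foot-edge : ∀ v → v ∉ D → Edge G (foot v) v)
  (cl : Fin n → Fin 3) (leg : Fin n → Fin n → Fin 3)
  (reaching : ∀ v → v ∉ D → Reaching G D cl v (foot v) (leg v))
  where

  new< : ∀ (c : Fin 3) → q + toℕ c < q + 3
  new< c = +-monoʳ-< q (toℕ<n c)

  new-injective : ∀ {c d : Fin 3} → q + toℕ c ≡ q + toℕ d → c ≡ d
  new-injective e = toℕ-injective (+-cancelˡ-≡ q _ _ e)

  abstract
    col : Fin n → Fin n → ℕ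
    col u v with u ∈? D | v ∈? D
    ... | yes _ | yes _ = colD u v
    ... | yes _ | no _  = q + toℕ (leg v u)
    ... | no _  | yes _ = q + toℕ (leg u v)
    -- Edges within a class get a junk colour; no tree constructed below uses them.
    ... | no _  | no _  = q + toℕ (third (cl u) (cl v))

    col-in : ∀ {u v} → u ∈ D → v ∈ D → col u v ≡ colD u v
    col-in {u} {v} u∈ v∈ with u ∈? D | v ∈? D
    ... | yes _ | yes _ = refl
    ... | no u∉ | _     = contradiction u∈ u∉
    ... | yes _ | no v∉ = contradiction v∈ v∉

    col-down : ∀ {u v} → u ∈ D → v ∉ D → col u v ≡ q + toℕ (leg v u)
    col-down {u} {v} u∈ v∉ with u ∈? D | v ∈? D
    ... | yes _ | yes v∈ = contradiction v∈ v∉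
    ... | no u∉ | _     = contradiction u∈ u∉
    ... | yes _ | no _ = refl

    col-up : ∀ {u v} → u ∉ D → v ∈ D → col u v ≡ q + toℕ (leg u v)
    col-up {u} {v} u∉ v∈ with u ∈? D | v ∈? D
    ... | yes u∈ | _     = contradiction u∈ u∉
    ... | no _   | no v∉ = contradiction v∈ v∉
    ... | no _   | yes _ = refl

    col-out : ∀ {u v} → u ∉ D → v ∉ D → col u v ≡ q + toℕ (third (cl u) (cl v))
    col-out {u} {v} u∉ v∉ with u ∈? D | v ∈? D
    ... | yes u∈ | _      = contradiction u∈ u∉
    ... | no _   | yes v∈ = contradiction v∈ v∉
    ... | no _   | no _   = refl

    col-isColoring : IsColoring G ⊤ (q + 3) col
    col-isColoring = (λ u v _ _ → bounded u v) , λ u v _ _ → symmetric u v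
      where
      bounded : ∀ u v → Edge G u v → col u v < q + 3
      bounded u v uv with u ∈? D | v ∈? D
      ... | yes u∈ | yes v∈ = <-≤-trans (proj₁ isCol u v u∈ v∈ uv) (m≤m+n q 3)
      ... | yes _  | no _   = new< (leg v u)
      ... | no _   | yes _  = new< (leg u v)
      ... | no _   | no _   = new< (third (cl u) (cl v))

      symmetric : ∀ u v → Edge G u v → col u v ≡ col v u
      symmetric u v uv with u ∈? D | v ∈? D
      ... | yes u∈ | yes v∈ = proj₂ isCol u v u∈ v∈ uv
      ... | yes _  | no _   = refl
      ... | no _   | yes _  = refl
      ... | no _   | no _   = cong (λ c → q + toℕ c) (third-comm (cl u) (cl v))

  -- C lists the leg colours in use; a further limb avoids all of them, whatever its foot.
  record Sprout (F L : List (Fin n)) (C : List (Fin 3)) : Set where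
    field
      {T}    : Subset n
      {E}    : Fin n → Fin n → Bool
      tree   : IsTreeIn G ⊤ T E
      proper : ProperEdges col E
      feet   : ∀ {v} → v ∈ₗ F → v ∈ T
      shoots : ∀ {v} → v ∈ₗ L → v ∈ T
      fresh  : ∀ {v} → v ∈ T → v ∉ D → v ∈ₗ L
      legs   : ∀ {f v} → f ∈ D → v ∉ D → E f v ≡ true → leg v f ∈ₗ C

  Tip : ∀ {F L C} → Sprout F L C → Fin n → Fin 3 → Set
  Tip S s c = ∀ w → Sprout.E S s w ≡ true → col s w ≡ q + toℕ c

  -- The feet are filled up to exactly `3 ⊓ ∣ D ∣` vertices, so the hypothesis on `D` applies even
  -- when feet coincide or `D` has fewer than three vertices.
  base : ∀ {f g h} → f ∈ D → g ∈ D → h ∈ D → Sprout (f ∷ g ∷ h ∷ []) [] []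
  base {f} {g} {h} f∈ g∈ h∈
    with between {S = S₀} S₀⊆D (⊓-glb (∣S∣≤length S₀ (f ∷ g ∷ h ∷ []) listed) (p⊆q⇒∣p∣≤∣q∣ S₀⊆D)) (m⊓n≤n 3 ∣ D ∣)
    where
    S₀ = ⁅ f ⁆ ∪ (⁅ g ⁆ ∪ ⁅ h ⁆)
    listed : ∀ {v} → v ∈ S₀ → v ∈ₗ f ∷ g ∷ h ∷ []
    listed v∈ with x∈p∪q⁻ ⁅ f ⁆ _ v∈
    ... | inj₁ v∈f = here (x∈⁅y⁆⇒x≡y f v∈f)
    ... | inj₂ v∈′ with x∈p∪q⁻ ⁅ g ⁆ _ v∈′
    ...   | inj₁ v∈g = there (here (x∈⁅y⁆⇒x≡y g v∈g))
    ...   | inj₂ v∈h = there (there (here (x∈⁅y⁆⇒x≡y h v∈h)))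
    S₀⊆D : S₀ ⊆ D
    S₀⊆D v∈ with listed v∈
    ... | here refl                 = f∈
    ... | there (here refl)         = g∈
    ... | there (there (here refl)) = h∈
  ... | M , S₀⊆M , M⊆D , ∣M∣ with 3-proper M M⊆D ∣M∣
  ...   | T , E , tr , M⊆T , pr = record
    { tree   = record { T⊆U = λ _ → ∈⊤ ; nonempty = nonempty ; sub = sub ; ends = ends
                      ; symE = symE ; conn = conn ; acyclic = acyclic }
    ; proper = λ u v w uv uw v≢w e → pr u v w uv uw v≢w (trans (≡.sym (inside-col uv)) (trans e (inside-col uw)))
    ; feet   = λ { (here refl) → M⊆T (S₀⊆M (x∈p∪q⁺ (inj₁ (x∈⁅x⁆ _))))
                 ; (there (here refl)) → M⊆T (S₀⊆M (x∈p∪q⁺ {p = ⁅ f ⁆} (inj₂ (x∈p∪q⁺ (inj₁ (x∈⁅x⁆ _))))))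
                 ; (there (there (here refl))) → M⊆T (S₀⊆M (x∈p∪q⁺ {p = ⁅ f ⁆} (inj₂ (x∈p∪q⁺ {p = ⁅ g ⁆} (inj₂ (x∈⁅x⁆ _)))))) }
    ; shoots = λ ()
    ; fresh  = λ v∈T v∉D → contradiction (T⊆U v∈T) v∉D
    ; legs   = λ {f} {v} _ v∉D fv → contradiction (T⊆U (proj₂ (ends f v fv))) v∉D
    }
    where
    open IsTreeIn tr
    inside-col : ∀ {u v} → E u v ≡ true → col u v ≡ colD u v
    inside-col {u} {v} uv = col-in (T⊆U (proj₁ (ends u v uv))) (T⊆U (proj₂ (ends u v uv)))

  module _ {F L C} (S : Sprout F L C) where
    open Sprout S

    -- At `f` the new edge meets edges inside `D`, whose colours lie below `q`, and legs, whose
    -- colours lie in `C`; neither kind can share its colour.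
    addLeg : ∀ {f v c} → f ∈ₗ F → f ∈ D → v ∉ D → Edge G f v → leg v f ≡ c → c ∉ₗ C → v ∉ₗ L →
             Σ (Sprout F (v ∷ L) (c ∷ C)) λ S′ → Tip S′ v c
    addLeg {f} {v} {c} f∈F f∈D v∉D fv legc c∉C v∉L = record
      { tree   = addLeaf tree (feet f∈F) v∉T ∈⊤ fv
      ; proper = addLeaf-proper {col = col} tree v∉T proper avoid
      ; feet   = λ u∈ → x∈p∪q⁺ (inj₁ (feet u∈))
      ; shoots = λ { (here refl) → x∈p∪q⁺ {p = T} (inj₂ (x∈⁅x⁆ v)) ; (there u∈) → x∈p∪q⁺ (inj₁ (shoots u∈)) }
      ; fresh  = fresh′
      ; legs   = legs′
      } , λ w e → trans (cong (col v) (leaf-nbr tree v∉T e)) (trans (col-up v∉D f∈D) (cong (λ c → q + toℕ c) legc))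
      where
      v∉T : v ∉ T
      v∉T v∈T = v∉L (fresh v∈T v∉D)

      avoid : ∀ w → E f w ≡ true → col f w ≢ col f v
      avoid w fw e with w ∈? D
      ... | yes w∈D = <⇒≢ (<-≤-trans (proj₁ isCol f w f∈D w∈D (IsTreeIn.sub tree f w fw)) (m≤m+n q _))
                          (trans (≡.sym (col-in f∈D w∈D)) (trans e (col-down f∈D v∉D)))
      ... | no w∉D  = c∉C (subst (_∈ₗ C)
                        (trans (new-injective (trans (≡.sym (col-down f∈D w∉D)) (trans e (col-down f∈D v∉D)))) legc)
                        (legs f∈D w∉D fw))

      fresh′ : ∀ {u} → u ∈ T ∪ ⁅ v ⁆ → u ∉ D → u ∈ₗ v ∷ L
      fresh′ u∈ u∉D with x∈p∪q⁻ T ⁅ v ⁆ u∈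
      ... | inj₁ u∈T = there (fresh u∈T u∉D)
      ... | inj₂ u∈v = here (x∈⁅y⁆⇒x≡y v u∈v)

      legs′ : ∀ {g u} → g ∈ D → u ∉ D → addEdge f v E g u ≡ true → leg u g ∈ₗ c ∷ C
      legs′ {g} {u} g∈D u∉D gu with addEdge⁻ f v E g u gu
      ... | inj₁ old                  = there (legs g∈D u∉D old)
      ... | inj₂ (inj₁ (refl , refl)) = here legc
      ... | inj₂ (inj₂ (refl , refl)) = contradiction g∈D v∉D

    addTwig : ∀ {s t c} → Tip S s c → s ∈ₗ L → s ∉ D → t ∉ D → Edge G s t → third (cl s) (cl t) ≢ c → t ∉ₗ L →
              Σ (Sprout F (t ∷ L) C) λ S′ → Tip S′ t (third (cl s) (cl t))
    addTwig {s} {t} {c} tip s∈L s∉D t∉D st ≢c t∉L = record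
      { tree   = addLeaf tree (shoots s∈L) t∉T ∈⊤ st
      ; proper = addLeaf-proper {col = col} tree t∉T proper
                   λ w sw e → ≢c (new-injective (trans (≡.sym (col-out s∉D t∉D)) (trans (≡.sym e) (tip w sw))))
      ; feet   = λ u∈ → x∈p∪q⁺ (inj₁ (feet u∈))
      ; shoots = λ { (here refl) → x∈p∪q⁺ {p = T} (inj₂ (x∈⁅x⁆ t)) ; (there u∈) → x∈p∪q⁺ (inj₁ (shoots u∈)) }
      ; fresh  = fresh′
      ; legs   = legs′
      } , λ w e → trans (cong (col t) (leaf-nbr tree t∉T e))
                    (trans (col-out t∉D s∉D) (cong (λ c → q + toℕ c) (third-comm (cl t) (cl s))))
      where
      t∉T : t ∉ T
      t∉T t∈T = t∉L (fresh t∈T t∉D)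

      fresh′ : ∀ {u} → u ∈ T ∪ ⁅ t ⁆ → u ∉ D → u ∈ₗ t ∷ L
      fresh′ u∈ u∉D with x∈p∪q⁻ T ⁅ t ⁆ u∈
      ... | inj₁ u∈T = there (fresh u∈T u∉D)
      ... | inj₂ u∈t = here (x∈⁅y⁆⇒x≡y t u∈t)

      legs′ : ∀ {g u} → g ∈ D → u ∉ D → addEdge s t E g u ≡ true → leg u g ∈ₗ C
      legs′ {g} {u} g∈D u∉D gu with addEdge⁻ s t E g u gu
      ... | inj₁ old                  = legs g∈D u∉D old
      ... | inj₂ (inj₁ (refl , refl)) = contradiction g∈D s∉D
      ... | inj₂ (inj₂ (refl , refl)) = contradiction g∈D t∉D

    relist : ∀ {L′} → (∀ {v} → v ∈ₗ L → v ∈ₗ L′) → (∀ {v} → v ∈ₗ L′ → v ∈ₗ L) → Sprout F L′ C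
    relist to from = record
      { tree = tree ; proper = proper ; feet = feet ; legs = legs
      ; shoots = λ v∈ → shoots (from v∈) ; fresh = λ v∈T v∉D → to (fresh v∈T v∉D) }

  -- The index `c` is the colour of the edge by which `s` was entered; the next edge is tested
  -- against it alone.
  data Twig (s : Fin n) (c : Fin 3) : List (Fin n) → Set where
    []   : Twig s c []
    grow : ∀ {t ts} → t ∉ D → Edge G s t → third (cl s) (cl t) ≢ c →
           Twig t (third (cl s) (cl t)) ts → Twig s c (t ∷ ts)

  addTwigs : ∀ {F L C s c ts} (S : Sprout F L C) → Tip S s c → s ∈ₗ L → s ∉ D → Twig s c ts → Unique ts →
             (∀ {v} → v ∈ₗ ts → v ∉ₗ L) → Sprout F (ts ++ L) C
  addTwigs S tip s∈L s∉D [] _ _ = S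
  addTwigs {L = L} S tip s∈L s∉D (grow {t} {ts} t∉D st ≢c tw) (t≢ ∷ uniq) ts∉L
    with addTwig S tip s∈L s∉D t∉D st ≢c (ts∉L (here refl))
  ... | S′ , tip′ = relist (addTwigs S′ tip′ (here refl) t∉D tw uniq ts∉L′) (∈-resp-↭ (shift t ts L)) (∈-resp-↭ (↭-sym (shift t ts L)))
    where
    ts∉L′ : ∀ {v} → v ∈ₗ ts → v ∉ₗ t ∷ L
    ts∉L′ v∈ (here refl) = All.lookup t≢ v∈ refl
    ts∉L′ v∈ (there v∈L) = ts∉L (there v∈) v∈L

  -- A path hanging from D, listed from its foot outwards; c is the colour of its leg.
  record Limb (c : Fin 3) : Set where
    field
      {base-foot root} : Fin n
      {twigs}  : List (Fin n)
      bf∈D     : base-foot ∈ D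
      root∉D   : root ∉ D
      edge     : Edge G base-foot root
      legc     : leg root base-foot ≡ c
      twig     : Twig root c twigs
      uniq     : Unique (root ∷ twigs)

    verts : List (Fin n)
    verts = root ∷ twigs

  open Limb using (verts; base-foot; bf∈D)

  addLimb : ∀ {F L C c} (l : Limb c) → Sprout F L C → base-foot l ∈ₗ F → c ∉ₗ C →
            (∀ {v} → v ∈ₗ verts l → v ∉ₗ L) → Sprout F (verts l ++ L) (c ∷ C)
  addLimb {L = L} l S f∈F c∉C vs∉L with Limb.uniq l
  ... | root≢ ∷ uniq with addLeg S f∈F (bf∈D l) (Limb.root∉D l) (Limb.edge l) (Limb.legc l) c∉C (vs∉L (here refl))
  ...   | S′ , tip = relist (addTwigs S′ tip (here refl) (Limb.root∉D l) (Limb.twig l) uniq ts∉) (∈-resp-↭ (shift _ ts L)) (∈-resp-↭ (↭-sym (shift _ ts L)))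
    where
    ts = Limb.twigs l

    ts∉ : ∀ {v} → v ∈ₗ ts → v ∉ₗ Limb.root l ∷ L
    ts∉ v∈ (here refl) = All.lookup root≢ v∈ refl
    ts∉ v∈ (there v∈L) = vs∉L (there v∈) v∈L

  _#_ : ∀ {c d} → Limb c → Limb d → Set
  l # m = ∀ {v} → v ∈ₗ verts l → v ∉ₗ verts m

  Joined : List (Fin n) → Set
  Joined xs = ∃[ T ] ∃[ E ] (IsTreeIn G ⊤ T E × (∀ {v} → v ∈ₗ xs → v ∈ T) × ProperEdges col E)

  Joined-⊆ : ∀ {xs ys} → All (_∈ₗ ys) xs → Joined ys → Joined xs
  Joined-⊆ xs⊆ys (T , E , tr , ys⊆T , pr) = T , E , tr , (λ v∈ → ys⊆T (All.lookup xs⊆ys v∈)) , pr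

  join : ∀ {F L C} → Sprout F L C → Joined (F ++ L)
  join {F} S = T , E , tree , (λ v∈ → Sum.[ feet , shoots ] (∈-++⁻ F v∈)) , proper
    where open Sprout S

  joinLimb : ∀ {c s t} (l : Limb c) → s ∈ D → t ∈ D → Joined (base-foot l ∷ s ∷ t ∷ verts l ++ [])
  joinLimb l s∈D t∈D = join (addLimb l (base (bf∈D l) s∈D t∈D) (here refl) (λ ()) (λ _ ()))

  joinLimbs₂ : ∀ {c d s} (l : Limb c) (m : Limb d) → c ≢ d → l # m → s ∈ D →
               Joined (base-foot l ∷ base-foot m ∷ s ∷ verts l ++ verts m ++ [])
  joinLimbs₂ l m c≢d l#m s∈D =
    join (addLimb l (addLimb m (base (bf∈D l) (bf∈D m) s∈D) (there (here refl)) (λ ()) (λ _ ()))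
            (here refl) (λ { (here e) → c≢d e })
            (λ v∈ v∈′ → Sum.[ l#m v∈ , (λ ()) ] (∈-++⁻ (verts m) v∈′)))

  -- Different leg colours make coinciding feet harmless, and disjointness makes every added vertex
  -- a new leaf.
  joinLimbs₃ : ∀ {c d e x y z} (l : Limb c) (m : Limb d) (k : Limb e) → Distinct c d e → l # m → l # k → m # k →
               x ∈ₗ verts l → y ∈ₗ verts m → z ∈ₗ verts k → Joined (x ∷ y ∷ z ∷ [])
  joinLimbs₃ l m k (c≢d , c≢e , d≢e) l#m l#k m#k x∈ y∈ z∈ =
    Joined-⊆ ( there (there (there (∈-++⁺ˡ x∈)))
             ∷ there (there (there (∈-++⁺ʳ (verts l) (∈-++⁺ˡ y∈))))
             ∷ there (there (there (∈-++⁺ʳ (verts l) (∈-++⁺ʳ (verts m) (∈-++⁺ˡ z∈))))) ∷ [])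
    (join (addLimb l (addLimb m (addLimb k (base (bf∈D l) (bf∈D m) (bf∈D k))
              (there (there (here refl))) (λ ()) (λ _ ()))
            (there (here refl)) (λ { (here e) → d≢e e })
            (λ v∈ v∈′ → Sum.[ m#k v∈ , (λ ()) ] (∈-++⁻ (verts k) v∈′)))
          (here refl) (λ { (here e) → c≢d e ; (there (here e)) → c≢e e })
          (λ v∈ v∈′ → Sum.[ l#m v∈ , (λ v∈″ → Sum.[ l#k v∈ , (λ ()) ] (∈-++⁻ (verts k) v∈″)) ] (∈-++⁻ (verts m) v∈′))))

  -- Limbs that reach a given vertex

  LimbTo : Fin n → Fin 3 → (Fin n → Set) → Set
  LimbTo v c P = Σ (Limb c) λ l → v ∈ₗ verts l × (∀ {u} → u ∈ₗ verts l → P u)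

  direct : ∀ {v} → v ∉ D → LimbTo v (cl v) (_≡ v)
  direct {v} v∉D = record
    { bf∈D = foot∈D v v∉D ; root∉D = v∉D ; edge = foot-edge v v∉D ; legc = proj₁ (reaching v v∉D)
    ; twig = [] ; uniq = [] ∷ [] } , here refl , λ { (here e) → e }

  -- The edge from `a` to `v` has the third class as its colour, hence differs from the main leg of
  -- `a`, which has colour `cl a`.
  viaLimb : ∀ {v a} → v ∉ D → a ∉ D → Edge G v a → cl a ≢ cl v →
            Σ (LimbTo v (cl a) (λ u → u ≡ v ⊎ u ≡ a)) λ l → a ∈ₗ verts (proj₁ l)
  viaLimb {v} {a} v∉D a∉D va a≁v = (record
    { bf∈D = foot∈D a a∉D ; root∉D = a∉D ; edge = foot-edge a a∉D ; legc = proj₁ (reaching a a∉D)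
    ; twig = grow v∉D (Edge-sym G va) (third≢ˡ (cl a) (cl v) a≁v) []
    ; uniq = ((λ { refl → a≁v refl }) ∷ []) ∷ [] ∷ [] } ,
    there (here refl) , λ { (here e) → inj₂ e ; (there (here e)) → inj₁ e }) , here refl

  -- A vertex of the limb other than `v` is known by its class only, which is enough to prove limbs
  -- disjoint.
  stepLimb : ∀ {v j} → v ∉ D → j ≢ cl v → Step G D cl v (leg v) j → LimbTo v j (λ u → u ≡ v ⊎ cl u ≡ j)
  stepLimb v∉D j≢ (inj₁ (f , f∈D , vf , legc)) = record
    { bf∈D = f∈D ; root∉D = v∉D ; edge = Edge-sym G vf ; legc = legc ; twig = [] ; uniq = [] ∷ [] } ,
    here refl , λ { (here e) → inj₁ e }
  stepLimb v∉D j≢ (inj₂ (a , a∉D , va , refl)) with viaLimb v∉D a∉D va j≢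
  ... | (l , v∈ , only) , _ = l , v∈ , λ u∈ → Sum.map₂ (cong cl) (only u∈)

  -- With classes `i`, `j`, `k` of `v`, `a`, `w`, the colours from the foot outwards are `k`, `i`,
  -- `k`.
  farLimb : ∀ {v} → v ∉ D → (p : Poor G D cl v) →
            LimbTo v (cl (Poor.w p)) (λ u → u ≡ v ⊎ u ≡ Poor.a p ⊎ cl u ≡ cl (Poor.w p))
  farLimb {v} v∉D p = record
    { bf∈D = foot∈D w w∉D ; root∉D = w∉D ; edge = foot-edge w w∉D ; legc = proj₁ (reaching w w∉D)
    ; twig = grow a∉D (Edge-sym G aw) (third≢ˡ (cl w) (cl a) (≢-sym j≢k))
               (grow v∉D (Edge-sym G va) alternate [])
    ; uniq = ((λ { refl → j≢k refl }) ∷ (λ { refl → i≢k refl }) ∷ []) ∷ ((λ { refl → i≢j refl }) ∷ []) ∷ [] ∷ [] } ,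
    there (there (here refl)) ,
    λ { (here refl) → inj₂ (inj₂ refl) ; (there (here e)) → inj₂ (inj₁ e) ; (there (there (here e))) → inj₁ e }
    where
    open Poor p
    i≢j = proj₁ dist
    i≢k = proj₁ (proj₂ dist)
    j≢k = proj₂ (proj₂ dist)

    alternate : third (cl a) (cl v) ≢ third (cl w) (cl a)
    alternate e = i≢k (trans (≡.sym (third-unique (cl w) (cl a) (cl v) (≢-sym j≢k) (≢-sym i≢k) (≢-sym i≢j)))
                        (trans (≡.sym e) (third-unique (cl a) (cl v) (cl w) (≢-sym i≢j) j≢k i≢k)))

  someStep : ∀ {v} → v ∉ D → ∃[ j ] (j ≢ cl v × Step G D cl v (leg v) j)
  someStep {v} v∉D with proj₂ (reaching v v∉D)
  ... | inj₁ steps = next (cl v) , next≢ (cl v) , steps _ (next≢ (cl v))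
  ... | inj₂ p     = cl a , ≢-sym (proj₁ dist) , inj₂ (a , a∉D , va , refl)
    where open Poor p

  -- Joining up to three vertices

  joinOne : ∀ {x s t} → x ∉ D → s ∈ D → t ∈ D → Joined (x ∷ s ∷ t ∷ [])
  joinOne x∉D s∈D t∈D with direct x∉D
  ... | l , x∈ , _ =
    Joined-⊆ (there (there (there (∈-++⁺ˡ x∈))) ∷ there (here refl) ∷ there (there (here refl)) ∷ [])
      (joinLimb l s∈D t∈D)

  joinTwo : ∀ {x y s} → x ≢ y → x ∉ D → y ∉ D → s ∈ D → Joined (x ∷ y ∷ s ∷ [])
  joinTwo {x} {y} {s} x≢y x∉D y∉D s∈D with direct x∉D
  ... | l , x∈ , only-x with cl x ≟ cl y
  ...   | no i≢j with direct y∉D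
  ...     | m , y∈ , only-y =
    Joined-⊆ (there (there (there (∈-++⁺ˡ x∈))) ∷ there (there (there (∈-++⁺ʳ (verts l) (∈-++⁺ˡ y∈)))) ∷
              there (there (here refl)) ∷ [])
      (joinLimbs₂ l m i≢j (λ u∈l u∈m → x≢y (trans (≡.sym (only-x u∈l)) (only-y u∈m))) s∈D)
  joinTwo {x} {y} x≢y x∉D y∉D s∈D | l , x∈ , only-x | yes same with someStep y∉D
  ... | j , j≢ , step with stepLimb y∉D j≢ step
  ...   | m , y∈ , only-y =
    Joined-⊆ (there (there (there (∈-++⁺ˡ x∈))) ∷ there (there (there (∈-++⁺ʳ (verts l) (∈-++⁺ˡ y∈)))) ∷
              there (there (here refl)) ∷ [])
      (joinLimbs₂ l m (λ e → j≢ (trans (≡.sym e) same)) disjoint s∈D)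
    where
    disjoint : l # m
    disjoint u∈l u∈m with only-x u∈l | only-y u∈m
    ... | refl | inj₁ x≡y = x≢y x≡y
    ... | refl | inj₂ e   = j≢ (trans (≡.sym e) same)

  module _ {x y z : Fin n} (x≢y : x ≢ y) (x≢z : x ≢ z) (y≢z : y ≢ z)
           (x∉D : x ∉ D) (y∉D : y ∉ D) (z∉D : z ∉ D) where

    -- The vertices `x`, `y`, `z` share a class, while intermediate vertices have class `j` on one
    -- limb and `k` on the other, so the limbs cannot meet.
    joinSteps : ∀ {j k} → cl y ≡ cl x → cl z ≡ cl x → Distinct (cl x) j k →
                Step G D cl y (leg y) j → Step G D cl z (leg z) k → Joined (x ∷ y ∷ z ∷ [])
    joinSteps {j} {k} y~x z~x (i≢j , i≢k , j≢k) step-y step-z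
      with direct x∉D | stepLimb y∉D (λ e → i≢j (≡.sym (trans e y~x))) step-y
         | stepLimb z∉D (λ e → i≢k (≡.sym (trans e z~x))) step-z
    ... | l , x∈ , only-x | m , y∈ , only-y | k′ , z∈ , only-z =
      joinLimbs₃ l m k′ (i≢j , i≢k , j≢k) l#m l#k m#k x∈ y∈ z∈
      where
      l#m : l # m
      l#m u∈l u∈m with only-x u∈l | only-y u∈m
      ... | refl | inj₁ e = x≢y e
      ... | refl | inj₂ e = i≢j e

      l#k : l # k′
      l#k u∈l u∈k with only-x u∈l | only-z u∈k
      ... | refl | inj₁ e = x≢z e
      ... | refl | inj₂ e = i≢k e

      m#k : m # k′
      m#k u∈m u∈k with only-y u∈m | only-z u∈k
      ... | inj₁ refl | inj₁ e    = y≢z e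
      ... | inj₁ refl | inj₂ e    = i≢k (trans (≡.sym y~x) e)
      ... | inj₂ e    | inj₁ refl = i≢j (trans (≡.sym z~x) e)
      ... | inj₂ e    | inj₂ e′   = j≢k (trans (≡.sym e) e′)

    -- z occupies Poor.a p on its way to the third class, so y descends through a different vertex of that class.
    joinPoor : cl y ≡ cl x → cl z ≡ cl x → (p : Poor G D cl z) →
               ∃[ a ] (a ∉ D × Edge G y a × cl a ≡ cl (Poor.a p) × a ≢ Poor.a p) → Joined (x ∷ y ∷ z ∷ [])
    joinPoor y~x z~x p (a′ , a′∉D , ya′ , same , a′≢a)
      with direct x∉D | viaLimb y∉D a′∉D ya′ j≢y | farLimb z∉D p
      where
      j≢y : cl a′ ≢ cl y
      j≢y e = proj₁ (Poor.dist p) (trans z~x (trans (≡.sym y~x) (trans (≡.sym e) same)))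
    ... | l , x∈ , only-x | (m , y∈ , only-y) , _ | k , z∈ , only-z =
      joinLimbs₃ l m k ((λ e → i≢j (trans e same)) , i≢k , λ e → j≢k (trans (≡.sym same) e)) l#m l#k m#k x∈ y∈ z∈
      where
      open Poor p
      i≢j = subst (_≢ cl a) z~x (proj₁ dist)
      i≢k = subst (_≢ cl w) z~x (proj₁ (proj₂ dist))
      j≢k = proj₂ (proj₂ dist)

      l#m : l # m
      l#m u∈l u∈m with only-x u∈l | only-y u∈m
      ... | refl | inj₁ e    = x≢y e
      ... | refl | inj₂ refl = i≢j same

      l#k : l # k
      l#k u∈l u∈k with only-x u∈l | only-z u∈k
      ... | refl | inj₁ e           = x≢z e
      ... | refl | inj₂ (inj₁ refl) = i≢j refl
      ... | refl | inj₂ (inj₂ e)    = i≢k e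

      m#k : m # k
      m#k u∈m u∈k with only-y u∈m | only-z u∈k
      ... | inj₁ refl | inj₁ e           = y≢z e
      ... | inj₁ refl | inj₂ (inj₁ refl) = i≢j (≡.sym y~x)
      ... | inj₁ refl | inj₂ (inj₂ e)    = i≢k (trans (≡.sym y~x) e)
      ... | inj₂ refl | inj₁ refl        = i≢j (trans (≡.sym z~x) same)
      ... | inj₂ refl | inj₂ (inj₁ e)    = a′≢a e
      ... | inj₂ refl | inj₂ (inj₂ e)    = j≢k (trans (≡.sym same) e)

    -- The main leg goes to `x`. If `y` or `z` has both steps, the other one chooses first. If both
    -- are poor towards different classes, one step each suffices; towards the same class, `z` takes
    -- its far route and `y` whichever of its twins is not on it.
    joinSame : cl y ≡ cl x → cl z ≡ cl x → Joined (x ∷ y ∷ z ∷ [])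
    joinSame y~x z~x with proj₂ (reaching y y∉D) | proj₂ (reaching z z∉D)
    ... | inj₁ steps | _ with someStep z∉D
    ...   | k , k≢ , step-z = joinSteps y~x z~x (≢-sym j≢i , (λ e → k≢ (trans (≡.sym e) (≡.sym z~x))) , third≢ʳ (cl x) k i≢k)
                                (steps _ (λ e → j≢i (trans e y~x))) step-z
      where
      i≢k : cl x ≢ k
      i≢k e = k≢ (trans (≡.sym e) (≡.sym z~x))
      j≢i = third≢ˡ (cl x) k i≢k
    joinSame y~x z~x | inj₂ p | inj₁ steps =
      joinSteps y~x z~x (i≢j , ≢-sym k≢i , ≢-sym (third≢ʳ (cl x) (cl a) i≢j))
        (inj₂ (a , a∉D , va , refl)) (steps _ (λ e → k≢i (trans e z~x)))
      where
      open Poor p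
      i≢j = subst (_≢ cl a) y~x (proj₁ dist)
      k≢i = third≢ˡ (cl x) (cl a) i≢j
    joinSame y~x z~x | inj₂ p | inj₂ r with cl (Poor.a p) ≟ cl (Poor.a r)
    ... | no j≢k = joinSteps y~x z~x
                     ((λ e → proj₁ (Poor.dist p) (trans y~x e)) , (λ e → proj₁ (Poor.dist r) (trans z~x e)) , j≢k)
                     (inj₂ (_ , Poor.a∉D p , Poor.va p , refl)) (inj₂ (_ , Poor.a∉D r , Poor.va r , refl))
    ... | yes same with Poor.a p ≟ Poor.a r
    ...   | no a≢   = joinPoor y~x z~x r (_ , Poor.a∉D p , Poor.va p , same , a≢)
    ...   | yes a≡a = joinPoor y~x z~x r (_ , Poor.b∉D p , Poor.vb p , trans (≡.sym (Poor.sameClass p)) same ,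
                                            λ e → Poor.a≢b p (trans a≡a (≡.sym e)))

    -- With main legs for `x` and `z`, a limb of the third class `c` is sought for `y`. If `y` is
    -- poor and `a` is not of class `c`, then `a` has the class of `z` and `w` has class `c`, so the
    -- far route serves unless `a` is `z`.
    joinTwoSame : cl y ≡ cl x → cl x ≢ cl z → Joined (x ∷ y ∷ z ∷ [])
    joinTwoSame y~x i≢j with direct x∉D | direct z∉D
    ... | l , x∈ , only-x | k , z∈ , only-z = byReach (proj₂ (reaching y y∉D))
      where
      c   = third (cl x) (cl z)
      c≢i = third≢ˡ (cl x) (cl z) i≢j
      c≢j = third≢ʳ (cl x) (cl z) i≢j

      l#k : l # k
      l#k u∈l u∈k = x≢z (trans (≡.sym (only-x u∈l)) (only-z u∈k))

      byStep : Step G D cl y (leg y) c → Joined (x ∷ y ∷ z ∷ [])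
      byStep step with stepLimb y∉D (λ e → c≢i (trans e y~x)) step
      ... | m , y∈ , only-y = joinLimbs₃ l m k (≢-sym c≢i , i≢j , c≢j) l#m l#k m#k x∈ y∈ z∈
        where
        l#m : l # m
        l#m u∈l u∈m with only-x u∈l | only-y u∈m
        ... | refl | inj₁ e = x≢y e
        ... | refl | inj₂ e = c≢i (≡.sym e)

        m#k : m # k
        m#k u∈m u∈k with only-z u∈k | only-y u∈m
        ... | refl | inj₁ e = y≢z (≡.sym e)
        ... | refl | inj₂ e = c≢j (≡.sym e)

      byReach : (∀ j → j ≢ cl y → Step G D cl y (leg y) j) ⊎ Poor G D cl y → Joined (x ∷ y ∷ z ∷ [])
      byReach (inj₁ steps) = byStep (steps c (λ e → c≢i (trans e y~x)))
      byReach (inj₂ p) with cl (Poor.a p) ≟ c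
      ... | yes e = byStep (inj₂ (_ , Poor.a∉D p , Poor.va p , e))
      ... | no a≢c with Poor.a p ≟ z
      -- y hangs from z, and two limbs suffice.
      ...   | yes refl with viaLimb y∉D z∉D (Poor.va p) (λ e → i≢j (trans (≡.sym y~x) (≡.sym e)))
      ...     | (m , y∈ , only-y) , z∈m =
                Joined-⊆ ( there (there (there (∈-++⁺ˡ x∈)))
                         ∷ there (there (there (∈-++⁺ʳ (verts l) (∈-++⁺ˡ y∈))))
                         ∷ there (there (there (∈-++⁺ʳ (verts l) (∈-++⁺ˡ z∈m)))) ∷ [])
                  (joinLimbs₂ l m i≢j l#m (foot∈D x x∉D))
        where
        l#m : l # m
        l#m u∈l u∈m with only-x u∈l | only-y u∈m
        ... | refl | inj₁ e = x≢y e
        ... | refl | inj₂ e = x≢z e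

      byReach (inj₂ p) | no a≢c | no a≢z with farLimb y∉D p
      ... | m , y∈ , only-y = joinLimbs₃ l m k (i≢k , i≢j , λ e → j≢k (trans a~z (≡.sym e))) l#m l#k m#k x∈ y∈ z∈
        where
        open Poor p hiding (a≢b)
        i≢a = subst (_≢ cl a) y~x (proj₁ dist)
        i≢k = subst (_≢ cl w) y~x (proj₁ (proj₂ dist))
        j≢k = proj₂ (proj₂ dist)

        a~z : cl a ≡ cl z
        a~z = trans (≡.sym (third-unique (cl x) c (cl a) (≢-sym c≢i) i≢a (≢-sym a≢c)))
                    (third-unique (cl x) c (cl z) (≢-sym c≢i) i≢j c≢j)

        l#m : l # m
        l#m u∈l u∈m with only-x u∈l | only-y u∈m
        ... | refl | inj₁ e           = x≢y e
        ... | refl | inj₂ (inj₁ refl) = i≢a refl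
        ... | refl | inj₂ (inj₂ e)    = i≢k e

        m#k : m # k
        m#k u∈m u∈k with only-z u∈k | only-y u∈m
        ... | refl | inj₁ e        = y≢z (≡.sym e)
        ... | refl | inj₂ (inj₁ e) = a≢z (≡.sym e)
        ... | refl | inj₂ (inj₂ e) = j≢k (trans a~z e)

  joinThree : ∀ {x y z} → x ≢ y → x ≢ z → y ≢ z → x ∉ D → y ∉ D → z ∉ D → Joined (x ∷ y ∷ z ∷ [])
  joinThree {x} {y} {z} x≢y x≢z y≢z x∉D y∉D z∉D with cl y ≟ cl x | cl z ≟ cl x | cl z ≟ cl y
  ... | yes y~x | yes z~x | _       = joinSame x≢y x≢z y≢z x∉D y∉D z∉D y~x z~x
  ... | yes y~x | no z≁x  | _       = joinTwoSame x≢y x≢z y≢z x∉D y∉D z∉D y~x (≢-sym z≁x)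
  ... | no y≁x  | yes z~x | _       =
    Joined-⊆ (here refl ∷ there (there (here refl)) ∷ there (here refl) ∷ []) (joinTwoSame x≢z x≢y (≢-sym y≢z) x∉D z∉D y∉D z~x (≢-sym y≁x))
  ... | no y≁x  | no z≁x  | yes z~y =
    Joined-⊆ (there (there (here refl)) ∷ here refl ∷ there (here refl) ∷ []) (joinTwoSame y≢z (≢-sym x≢y) (≢-sym x≢z) y∉D z∉D x∉D z~y y≁x)
  ... | no y≁x  | no z≁x  | no z≁y with direct x∉D | direct y∉D | direct z∉D
  ...   | l , x∈ , only-x | m , y∈ , only-y | k , z∈ , only-z =
    joinLimbs₃ l m k (≢-sym y≁x , ≢-sym z≁x , ≢-sym z≁y)
      (λ u∈ u∈′ → x≢y (trans (≡.sym (only-x u∈)) (only-y u∈′)))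
      (λ u∈ u∈′ → x≢z (trans (≡.sym (only-x u∈)) (only-z u∈′)))
      (λ u∈ u∈′ → y≢z (trans (≡.sym (only-y u∈)) (only-z u∈′))) x∈ y∈ z∈

  -- The place of a repeated vertex is filled with a foot, which stands for an arbitrary vertex of
  -- `D`.
  joinOut : ∀ x y z → x ∉ D → y ∉ D → z ∉ D → Joined (x ∷ y ∷ z ∷ [])
  joinOut x y z x∉D y∉D z∉D with x ≟ y | x ≟ z | y ≟ z
  ... | no x≢y   | no x≢z   | no y≢z   = joinThree x≢y x≢z y≢z x∉D y∉D z∉D
  ... | no x≢y   | no _     | yes refl =
    Joined-⊆ (here refl ∷ there (here refl) ∷ there (here refl) ∷ []) (joinTwo x≢y x∉D y∉D (foot∈D x x∉D))
  ... | no x≢y   | yes refl | _        =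
    Joined-⊆ (here refl ∷ there (here refl) ∷ here refl ∷ []) (joinTwo x≢y x∉D y∉D (foot∈D x x∉D))
  ... | yes refl | no x≢z   | _        =
    Joined-⊆ (here refl ∷ here refl ∷ there (here refl) ∷ []) (joinTwo x≢z x∉D z∉D (foot∈D x x∉D))
  ... | yes refl | yes refl | _        =
    Joined-⊆ (here refl ∷ here refl ∷ here refl ∷ []) (joinOne x∉D (foot∈D x x∉D) (foot∈D x x∉D))

  joinPair : ∀ x y {s} → x ∉ D → y ∉ D → s ∈ D → Joined (x ∷ y ∷ s ∷ [])
  joinPair x y x∉D y∉D s∈D with x ≟ y
  ... | no x≢y   = joinTwo x≢y x∉D y∉D s∈D
  ... | yes refl = Joined-⊆ (here refl ∷ here refl ∷ there (here refl) ∷ []) (joinOne x∉D s∈D s∈D)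

  joinAny : ∀ x y z → Joined (x ∷ y ∷ z ∷ [])
  joinAny x y z with x ∈? D | y ∈? D | z ∈? D
  ... | yes x∈ | yes y∈ | yes z∈ = join (base x∈ y∈ z∈)
  ... | no x∉  | yes y∈ | yes z∈ = joinOne x∉ y∈ z∈
  ... | yes x∈ | no y∉  | yes z∈ =
    Joined-⊆ (there (here refl) ∷ here refl ∷ there (there (here refl)) ∷ []) (joinOne y∉ x∈ z∈)
  ... | yes x∈ | yes y∈ | no z∉  =
    Joined-⊆ (there (here refl) ∷ there (there (here refl)) ∷ here refl ∷ []) (joinOne z∉ x∈ y∈)
  ... | no x∉  | no y∉  | yes z∈ = joinPair x y x∉ y∉ z∈
  ... | no x∉  | yes y∈ | no z∉  =
    Joined-⊆ (here refl ∷ there (there (here refl)) ∷ there (here refl) ∷ []) (joinPair x z x∉ z∉ y∈)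
  ... | yes x∈ | no y∉  | no z∉  =
    Joined-⊆ (there (there (here refl)) ∷ here refl ∷ there (here refl) ∷ []) (joinPair y z y∉ z∉ x∈)
  ... | no x∉  | no y∉  | no z∉  = joinOut x y z x∉ y∉ z∉

  colorable : Fin n → Colorable G ⊤ 3 (q + 3)
  colorable o = col , col-isColoring , λ S _ ∣S∣ → spans S (≤-trans (≤-reflexive ∣S∣) (m⊓n≤m 3 ∣ ⊤ {n} ∣))
    where
    spans : ∀ S → ∣ S ∣ ≤ 3 → ∃[ T ] ∃[ E ] (IsTreeIn G ⊤ T E × S ⊆ T × ProperEdges col E)
    spans S ∣S∣≤3 with atMostThree S o ∣S∣≤3
    ... | x , y , z , S⊆xyz with joinAny x y z
    ...   | T , E , tr , xyz⊆T , pr = T , E , tr , (λ v∈S → xyz⊆T (S⊆xyz v∈S)) , pr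

-- Turns a choice available only outside `D` into a total one, so that feet and legs become
-- functions on all vertices.
whenOutside : ∀ (D : Subset n) {A : Set} {P : A → Set} v → A → (v ∉ D → ∃ P) → ∃[ a ] (v ∉ D → P a)
whenOutside D v default f with v ∈? D
... | yes v∈D = default , contradiction v∈D
... | no v∉D  = proj₁ (f v∉D) , λ _ → proj₂ (f v∉D)

dominated-colorable : ∀ (G : Graph n) D {q} → Connected3WayDominating G D → Colorable G D 3 q → Colorable G ⊤ 3 (q + 3)
dominated-colorable {n} G D (dom , ((o , _) , _) , deg) (colD , isCol , 3-proper) =
  Extension.colorable G D isCol 3-proper foot
    (λ v v∉D → proj₁ (proj₂ (feet v) v∉D)) (λ v v∉D → proj₂ (proj₂ (feet v) v∉D))
    (proj₁ classes) (λ v → proj₁ (legs v)) (λ v → proj₂ (legs v)) o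
  where
  feet : ∀ v → ∃[ f ] (v ∉ D → f ∈ D × Edge G f v)
  feet v = whenOutside D v o (dom v)

  foot : Fin n → Fin n
  foot v = proj₁ (feet v)

  classes = reaching G D foot deg o

  legs : ∀ v → ∃[ leg ] (v ∉ D → Reaching G D (proj₁ classes) v (foot v) leg)
  legs v = whenOutside D v (λ _ → 0F) (proj₂ classes v)

-- The extremal example

-- The hub 0 is alone in block 0; blocks 1, 2, 3 are the triangles.
block : Fin 10 → ℕ
block v = (toℕ v + 2) / 3

windmill : Graph 10
windmill = record { adj = joined ; sym = toWitness {a? = all? λ u → all? λ v → joined u v ≟ᵇ joined v u} tt
                  ; irrefl = toWitness {a? = all? λ u → joined u u ≟ᵇ false} tt }
  where
  joined : Fin 10 → Fin 10 → Bool
  joined u v = not ⌊ u ≟ v ⌋ ∧ (⌊ u ≟ zero ⌋ ∨ ⌊ v ≟ zero ⌋ ∨ ⌊ block u ≟ℕ block v ⌋)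

hub : Subset 10
hub = ⁅ zero ⁆

hub-edge : ∀ v → v ≢ zero → Edge windmill zero v
hub-edge = toWitness {a? = all? λ v → ¬? (v ≟ zero) →-dec (adj windmill zero v ≟ᵇ true)} tt

∉hub : ∀ {v} → v ∉ hub → v ≢ zero
∉hub v∉ refl = v∉ (x∈⁅x⁆ zero)

windmill-connected : Connected windmill
windmill-connected = s≤s z≤n , λ u v → toHub u ◅◅ fromHub v
  where
  toHub : ∀ u → Star (Edge windmill) u zero
  toHub u with u ≟ zero
  ... | yes refl = ε
  ... | no u≢0   = Edge-sym windmill {zero} {u} (hub-edge u u≢0) ◅ ε

  fromHub : ∀ v → Star (Edge windmill) zero v
  fromHub v with v ≟ zero
  ... | yes refl = ε
  ... | no v≢0   = hub-edge v v≢0 ◅ ε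

hub-dominating : Connected3WayDominating windmill hub
hub-dominating =
  (λ v v∉ → zero , x∈⁅x⁆ zero , hub-edge v (∉hub v∉)) ,
  ((zero , x∈⁅x⁆ zero) , λ u v u∈ v∈ →
    subst (Star _ u) (trans (x∈⁅y⁆⇒x≡y zero u∈) (≡.sym (x∈⁅y⁆⇒x≡y zero v∈))) ε) ,
  λ v _ → degrees v
  where
  degrees : ∀ v → 3 ≤ degree windmill v
  degrees = toWitness {a? = all? λ v → 3 ≤? degree windmill v} tt

-- A single vertex spans no edge, so the bound `0` on colours holds vacuously and the one-vertex
-- tree suffices.
hub-colorable : Colorable windmill hub 3 0
hub-colorable = (λ _ _ → 0) ,
  ((λ u v u∈ v∈ uv → contradiction (trans (x∈⁅y⁆⇒x≡y zero u∈) (≡.sym (x∈⁅y⁆⇒x≡y zero v∈))) (Edge⇒≢ windmill uv)) ,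
   λ _ _ _ _ _ → refl) ,
  λ S S⊆hub _ → hub , (λ _ _ → false) , record
    { T⊆U      = λ v∈ → v∈
    ; nonempty = zero , x∈⁅x⁆ zero
    ; sub      = λ _ _ ()
    ; ends     = λ _ _ ()
    ; symE     = λ _ _ → refl
    ; conn     = λ u v u∈ v∈ → subst (Star _ u) (trans (x∈⁅y⁆⇒x≡y zero u∈) (≡.sym (x∈⁅y⁆⇒x≡y zero v∈))) ε
    ; acyclic  = λ { (_ , [] , () , _) ; (_ , _ ∷ _ , _ , _ , () ∷ _) }
    } , S⊆hub , λ _ _ _ ()

leaves-block : ∀ u v → Edge windmill u v → block u ≢ block v → u ≢ zero → v ≡ zero
leaves-block = toWitness {a? = all? λ u → all? λ v →
  (adj windmill u v ≟ᵇ true) →-dec ¬? (block u ≟ℕ block v) →-dec ¬? (u ≟ zero) →-dec (v ≟ zero)} tt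

-- Until it first meets the hub the walk stays in the triangle of `u`; the edge by which it enters
-- the hub is the one wanted.
exit : ∀ {E : Fin 10 → Fin 10 → Bool} → (∀ u v → E u v ≡ true → Edge windmill u v) →
       ∀ {u v} → Star (λ a b → E a b ≡ true) u v → u ≢ zero → block u ≢ block v →
       ∃[ w ] (E w zero ≡ true × block w ≡ block u)
exit sub ε _ u≁v = contradiction refl u≁v
exit sub {u} (_◅_ {j = w} uw path) u≢0 u≁v with w ≟ zero
... | yes refl = u , uw , refl
... | no w≢0 with block u ≟ℕ block w
...   | no u≁w = contradiction (leaves-block u w (sub u w uw) u≁w u≢0) w≢0
...   | yes u~w with exit sub path w≢0 (λ e → u≁v (trans u~w e))
...     | x , x0 , x~w = x , x0 , trans x~w (≡.sym u~w)

three-distinct : ∀ {a b c m : ℕ} → a < m → b < m → c < m → a ≢ b → a ≢ c → b ≢ c → 3 ≤ m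
three-distinct {a} {b} {c} {m} a< b< c< a≢b a≢c b≢c with 3 ≤? m
... | yes 3≤m = 3≤m
... | no 3≰m with pigeonhole (≰⇒> 3≰m) colours
  where
  colours : Fin 3 → Fin m
  colours 0F = fromℕ< a<
  colours 1F = fromℕ< b<
  colours 2F = fromℕ< c<
...   | 0F , 1F , _ , e = contradiction (fromℕ<-injective _ _ _ _ e) a≢b
...   | 0F , 2F , _ , e = contradiction (fromℕ<-injective _ _ _ _ e) a≢c
...   | 1F , 2F , _ , e = contradiction (fromℕ<-injective _ _ _ _ e) b≢c
...   | 0F , 0F , () , _
...   | 1F , 0F , () , _
...   | 1F , 1F , s≤s () , _
...   | 2F , 0F , () , _
...   | 2F , 1F , s≤s () , _
...   | 2F , 2F , s≤s (s≤s ()) , _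

windmill-needs-3 : ∀ c → Colorable windmill ⊤ 3 c → 3 ≤ c
windmill-needs-3 c (col , (bounded , _) , 3-proper) with 3-proper S (λ _ → ∈⊤) refl
  where
  S : Subset 10
  -- One vertex from each triangle.
  S = ⁅ # 1 ⁆ ∪ (⁅ # 4 ⁆ ∪ ⁅ # 7 ⁆)
... | T , E , tr , S⊆T , proper =
  three-distinct (small s₁) (small s₂) (small s₃)
    (differ s₁ s₂ λ ()) (differ s₁ s₃ λ ()) (differ s₂ s₃ λ ())
  where
  open IsTreeIn tr

  Spoke : ℕ → Set
  Spoke k = ∃[ w ] (E zero w ≡ true × block w ≡ k)

  spoke : ∀ {u v} → u ∈ T → v ∈ T → u ≢ zero → block u ≢ block v → Spoke (block u)
  spoke {u} {v} u∈ v∈ u≢0 u≁v with exit sub (conn u v u∈ v∈) u≢0 u≁v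
  ... | w , w0 , w~u = w , trans (symE zero w) w0 , w~u

  small : ∀ {k} (s : Spoke k) → col zero (proj₁ s) < c
  small (w , e , _) = bounded zero w ∈⊤ ∈⊤ (sub zero w e)

  differ : ∀ {k l} (s : Spoke k) (t : Spoke l) → k ≢ l → col zero (proj₁ s) ≢ col zero (proj₁ t)
  differ (w , e , w∈k) (x , e′ , x∈l) k≢l =
    proper zero w x e e′ λ { refl → k≢l (trans (≡.sym w∈k) x∈l) }

  1∈T : # 1 ∈ T
  1∈T = S⊆T (toWitness {a? = # 1 ∈? _} tt)

  4∈T : # 4 ∈ T
  4∈T = S⊆T (toWitness {a? = # 4 ∈? _} tt)

  s₁ = spoke 1∈T 4∈T (λ ()) (λ ())
  s₂ = spoke 4∈T 1∈T (λ ()) (λ ())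
  s₃ = spoke (S⊆T (toWitness {a? = # 7 ∈? _} tt)) 1∈T (λ ()) (λ ())

theorem3p1 : (∀ {n} (G : Graph n) (D : Subset n) → Connected G →
    Connected3WayDominating G D →
    ∀ p q → IsPx G ⊤ 3 p → IsPx G D 3 q → p ≤ q + 3)
    × (∃[ n ] Σ (Graph n) λ G → ∃[ D ] ∃[ p ] ∃[ q ]
    (Connected G × Connected3WayDominating G D ×
    IsPx G ⊤ 3 p × IsPx G D 3 q × p ≡ q + 3))
theorem3p1 =
  (λ G D _ dominating p q (_ , minimal) (colorable , _) → minimal (q + 3) (dominated-colorable G D dominating colorable)) ,
  10 , windmill , hub , 3 , 0 , windmill-connected , hub-dominating ,
  -- The colouring with three colours comes from the upper bound itself, applied to the hub with `q`
  -- equal to `0`.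
  (dominated-colorable windmill hub hub-dominating hub-colorable , windmill-needs-3) ,
  (hub-colorable , λ _ _ → z≤n) , refl
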